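{- There is an absolute constant $c>0$ such that the following holds. Let $\varepsilon>0$ and $C>0$, and let $G$ be a graph with $n$ vertices, average degree $d$, maximum degree at most $Cd$, and fewer than $(1-\varepsilon)\frac{d}{6n}\sum_{u\in V(G)} d(u)^2$ triangles. Then $\mathrm{sp}(G)\ge c\,\frac{\varepsilon^2}{C}d^2$.
   Context: All graphs are finite and simple; $d(u)$ is the degree of $u$. $\mathrm{mc}(G)$ denotes the maximum number of edges crossing a partition of $V(G)$ into two parts, and $\mathrm{sp}(G)=\mathrm{mc}(G)-e(G)/2$.
   Formalization: The parameters ε and C are taken to be rational numbers instead of real numbers; the real case follows by approximating ε from below and C from above by rationals. -}

module Defs where

open import Data.Bool using (Bool; true; false; _∧_; _xor_; if_then_else_)
open import Data.Nat using (ℕ; zero; suc; _+_; _*_; _⊔_; _<ᵇ_; NonZero)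
open import Data.Fin using (Fin; toℕ) renaming (zero to fz; suc to fs)
open import Data.List using (List; []; _∷_; map; foldr; concatMap)
open import Data.Vec.Functional using (Vector) renaming (_∷_ to _∷ᶠ_)
open import Data.Integer using (+_)
open import Data.Rational using (ℚ; _/_; _-_)
open import Relation.Binary.PropositionalEquality using (_≡_)

record Graph (n : ℕ) : Set where
  field
    adj    : Fin n → Fin n → Bool
    sym    : ∀ u v → adj u v ≡ adj v u
    irrefl : ∀ u → adj u u ≡ false
open Graph public

sumFin : ∀ {n} → (Fin n → ℕ) → ℕ
sumFin {zero}  f = 0
sumFin {suc n} f = f fz + sumFin (λ i → f (fs i))

ind : Bool → ℕ
ind true  = 1
ind false = 0

lt : ∀ {n} → Fin n → Fin n → Bool
lt u v = toℕ u <ᵇ toℕ v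

deg : ∀ {n} → Graph n → Fin n → ℕ
deg G u = sumFin λ v → ind (adj G u v)

sumDeg : ∀ {n} → Graph n → ℕ
sumDeg G = sumFin λ u → deg G u

sumDegSq : ∀ {n} → Graph n → ℕ
sumDegSq G = sumFin λ u → deg G u * deg G u

edges : ∀ {n} → Graph n → ℕ
edges G = sumFin λ u → sumFin λ v → ind (lt u v ∧ adj G u v)

triangles : ∀ {n} → Graph n → ℕ
triangles G = sumFin λ u → sumFin λ v → sumFin λ w →
  ind (lt u v ∧ lt v w ∧ adj G u v ∧ adj G v w ∧ adj G u w)

cut : ∀ {n} → Graph n → (Fin n → Bool) → ℕ
cut G S = sumFin λ u → sumFin λ v → ind (lt u v ∧ adj G u v ∧ (S u xor S v))

allParts : ∀ n → List (Vector Bool n)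
allParts zero    = (λ ()) ∷ []
allParts (suc n) = concatMap (λ S → (false ∷ᶠ S) ∷ (true ∷ᶠ S) ∷ []) (allParts n)

mc : ∀ {n} → Graph n → ℕ
mc {n} G = foldr _⊔_ 0 (map (cut G) (allParts n))

ℕtoℚ : ℕ → ℚ
ℕtoℚ k = (+ k) / 1

sp : ∀ {n} → Graph n → ℚ
sp G = ℕtoℚ (mc G) - ((+ edges G) / 2)

avgDeg : ∀ {n} .{{_ : NonZero n}} → Graph n → ℚ
avgDeg {n} G = (+ sumDeg G) / n

inv : (n : ℕ) .{{_ : NonZero n}} → ℚ
inv n = (+ 1) / n

{-# OPTIONS --safe #-}

-- For x in the cube [-1, 1]ⁿ let Q x = Σ a_uv x_u x_v. Rounding one coordinate at a time, sp G ≥ -Q x / 4.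
-- Write d_w for the neighbourhood vector of w minus the density D / n². Summed over all w, Q d_w is at most
-- -(D / n²) Σ deg² · (relative deficit of triangles), so a random ±d_w is a good cut, but only of size ε d³ / n.
-- To use many vertices w at once, take a minimiser x of κ Q + η L, where L is a weighted ℓ¹-norm. Being
-- piecewise linear in each coordinate, this functional has a minimiser in {-1, 0, 1}ⁿ, and setting a
-- coordinate to 0 shows that every x_u (a x)_u is at most a negative multiple of the weight of u in L.
-- Comparing x with the average over w and ± of the vectors (1 - m_w) x ± d_w, where m_w = a_w + D / n²
-- dominates |d_w|, the terms linear in m_w cost a multiple of |Q x| by the previous remark, the quadratic
-- ones are bounded by L x, and the gain is the triangle deficit. A suitable κ / η gives -Q x ≥ c ε² d² / C.

module Submission where

open import Defs hiding (sym)
open import Data.Nat using (ℕ; zero; suc; NonZero; _<ᵇ_; _⊔_)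
open import Data.Fin using (Fin; toℕ) renaming (zero to fz; suc to fs)
open import Data.Integer using (ℤ; +_; -[1+_]; -≤+; ∣_∣; 0ℤ; 1ℤ; +≤+; +<+)
open import Data.Integer.Tactic.RingSolver using (solve-∀)
open import Data.Bool using (Bool; true; false; not; _∧_; _xor_)
open import Data.Maybe using (Maybe; just; nothing)
open import Data.List using (List; []; map; foldr) renaming (_∷_ to _∷ˡ_)
open import Data.List.Relation.Unary.Any as Any using (Any; here; there)
open import Data.List.Relation.Unary.Any.Properties using (concatMap⁺)
open import Data.Vec.Functional using (_∷_)
open import Data.Fin.Properties using (toℕ-injective)
open import Data.Unit using (⊤; tt)
open import Data.Empty using (⊥-elim)
open import Data.Product using (Σ; ∃; _×_; _,_; proj₁; proj₂)
open import Data.Sum using (_⊎_; inj₁; inj₂)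
open import Relation.Binary.PropositionalEquality
import Data.Nat as ℕ
import Data.Nat.Properties as ℕ
import Data.Integer as ℤ
import Data.Integer.Properties as ℤ
import Data.Rational as ℚ
import Data.Rational.Properties as ℚ
import Data.Rational.Unnormalised as ℚᵘ
import Data.Rational.Unnormalised.Properties as ℚᵘ
open import Algebra.Properties.Semiring.Sum ℤ.+-*-semiring using (sum; sum-cong-≗; ∑-comm; ∑-distrib-+; *-distribˡ-sum)

module Integral where

  open import Data.Integer using (_+_; _*_; _-_; -_; _≤_; _<_)

  -- Sums and quadratic forms

  ≤-by : ∀ {i j} e → 0ℤ ≤ e → j - i ≡ e → i ≤ j
  ≤-by e 0≤e eq = ℤ.0≤i-j⇒j≤i (subst (0ℤ ≤_) (sym eq) 0≤e)

  0≤-+ : ∀ {i j} → 0ℤ ≤ i → 0ℤ ≤ j → 0ℤ ≤ i + j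
  0≤-+ = ℤ.+-mono-≤

  0≤-* : ∀ {i j} → 0ℤ ≤ i → 0ℤ ≤ j → 0ℤ ≤ i * j
  0≤-* {j = j} (+≤+ {n = m} _) 0≤j = subst (_≤ + m * j) (ℤ.*-zeroʳ (+ m)) (ℤ.*-monoˡ-≤-nonNeg (+ m) 0≤j)

  0≤+ : ∀ {k} → 0ℤ ≤ + k
  0≤+ = +≤+ ℕ.z≤n

  0≤-sq : ∀ i → 0ℤ ≤ i * i
  0≤-sq (+ k) = 0≤-* {+ k} {+ k} 0≤+ 0≤+
  0≤-sq -[1+ k ] = 0≤+

  *-monoˡ : ∀ {k i j} → 0ℤ ≤ k → i ≤ j → k * i ≤ k * j
  *-monoˡ (+≤+ {n = m} _) = ℤ.*-monoˡ-≤-nonNeg (+ m)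

  ≤∣∣ : ∀ i → i ≤ + ∣ i ∣
  ≤∣∣ (+ k) = ℤ.≤-refl
  ≤∣∣ -[1+ k ] = -≤+

  ∣+∣-≤ : ∀ i j → + ∣ i + j ∣ ≤ + ∣ i ∣ + + ∣ j ∣
  ∣+∣-≤ i j = +≤+ (ℤ.∣i+j∣≤∣i∣+∣j∣ i j)

  ∣-∣-≤ : ∀ i j → + ∣ i - j ∣ ≤ + ∣ i ∣ + + ∣ j ∣
  ∣-∣-≤ i j = +≤+ (ℤ.∣i-j∣≤∣i∣+∣j∣ i j)

  ∣*∣ : ∀ i j → + ∣ i * j ∣ ≡ + ∣ i ∣ * + ∣ j ∣
  ∣*∣ i j = trans (cong +_ (ℤ.abs-* i j)) (ℤ.pos-* ∣ i ∣ ∣ j ∣)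

  sum-mono : ∀ {n} {f g : Fin n → ℤ} → (∀ i → f i ≤ g i) → sum f ≤ sum g
  sum-mono {zero}  h = ℤ.≤-refl
  sum-mono {suc n} h = ℤ.+-mono-≤ (h fz) (sum-mono (λ i → h (fs i)))

  sum-nonneg : ∀ {n} {f : Fin n → ℤ} → (∀ i → 0ℤ ≤ f i) → 0ℤ ≤ sum f
  sum-nonneg {zero}  h = ℤ.≤-refl
  sum-nonneg {suc n} h = 0≤-+ (h fz) (sum-nonneg (λ i → h (fs i)))

  sum-const : ∀ n c → sum {n} (λ _ → c) ≡ + n * c
  sum-const zero c = refl
  sum-const (suc n) c = trans (cong (λ s → c + s) (sum-const n c)) (sym (ℤ.suc-* (+ n) c))

  sum-+ : ∀ {n} (f g : Fin n → ℤ) → sum (λ i → f i + g i) ≡ sum f + sum g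
  sum-+ = ∑-distrib-+

  sum-* : ∀ {n} c (f : Fin n → ℤ) → sum (λ i → c * f i) ≡ c * sum f
  sum-* c f = sym (*-distribˡ-sum c f)

  sum-lin₂ : ∀ {n} p q (f g : Fin n → ℤ) →
    sum (λ i → p * f i + q * g i) ≡ p * sum f + q * sum g
  sum-lin₂ p q f g = trans (sum-+ (λ i → p * f i) (λ i → q * g i)) (cong₂ _+_ (sum-* p f) (sum-* q g))

  sum-lin₃ : ∀ {n} p q r (f g h : Fin n → ℤ) →
    sum (λ i → p * f i + q * g i + r * h i) ≡ p * sum f + q * sum g + r * sum h
  sum-lin₃ p q r f g h = trans (sum-+ (λ i → p * f i + q * g i) (λ i → r * h i)) (cong₂ _+_ (sum-lin₂ p q f g) (sum-* r h))

  sum-lin₄ : ∀ {n} p q r s (f g h k : Fin n → ℤ) →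
    sum (λ i → p * f i + q * g i + r * h i + s * k i) ≡ p * sum f + q * sum g + r * sum h + s * sum k
  sum-lin₄ p q r s f g h k = trans (sum-+ (λ i → p * f i + q * g i + r * h i) (λ i → s * k i)) (cong₂ _+_ (sum-lin₃ p q r f g h) (sum-* s k))

  ∑∑ : ∀ {m n} → (Fin m → Fin n → ℤ) → ℤ
  ∑∑ f = sum λ u → sum (f u)

  ∑∑-cong : ∀ {m n} {f g : Fin m → Fin n → ℤ} → (∀ u v → f u v ≡ g u v) → ∑∑ f ≡ ∑∑ g
  ∑∑-cong h = sum-cong-≗ λ u → sum-cong-≗ (h u)

  ∑∑-lin₂ : ∀ {m n} p q (f g : Fin m → Fin n → ℤ) →
    ∑∑ (λ u v → p * f u v + q * g u v) ≡ p * ∑∑ f + q * ∑∑ g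
  ∑∑-lin₂ p q f g = trans (sum-cong-≗ λ u → sum-lin₂ p q (f u) (g u)) (sum-lin₂ p q (λ u → sum (f u)) (λ u → sum (g u)))

  ∑∑-* : ∀ {m n} p (f : Fin m → Fin n → ℤ) → ∑∑ (λ u v → p * f u v) ≡ p * ∑∑ f
  ∑∑-* p f = trans (sum-cong-≗ λ u → sum-* p (f u)) (sum-* p (λ u → sum (f u)))

  ∑∑-lin₄ : ∀ {m n} p q r s (f g h k : Fin m → Fin n → ℤ) →
    ∑∑ (λ u v → p * f u v + q * g u v + r * h u v + s * k u v) ≡ p * ∑∑ f + q * ∑∑ g + r * ∑∑ h + s * ∑∑ k
  ∑∑-lin₄ p q r s f g h k = trans (sum-cong-≗ λ u → sum-lin₄ p q r s (f u) (g u) (h u) (k u)) (sum-lin₄ p q r s (λ u → sum (f u)) (λ u → sum (g u)) (λ u → sum (h u)) (λ u → sum (k u)))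

  Mat : ℕ → Set
  Mat n = Fin n → Fin n → ℤ

  Q : ∀ {n} → Mat n → (Fin n → ℤ) → ℤ
  Q a x = ∑∑ λ u v → a u v * (x u * x v)

  L : ∀ {n} → (Fin n → ℤ) → (Fin n → ℤ) → ℤ
  L b x = sum λ u → b u * + ∣ x u ∣

  -- N² times the energy of the point z / N of the cube [-1, 1]ⁿ; ℓ collects the interaction with coordinates already fixed.
  energy : ∀ {n} → Mat n → (ℓ b : Fin n → ℤ) → ℤ → (Fin n → ℤ) → ℤ
  energy a ℓ b N z = Q a z + N * sum (λ u → ℓ u * z u) + N * L b z

  private
    *-swapˡ : ∀ p q r → p * (q * r) ≡ q * (p * r)
    *-swapˡ = solve-∀
    *-swapʳ : ∀ p q r → p * (r * q) ≡ q * (p * r)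
    *-swapʳ = solve-∀
    linear-expand : ∀ ℓ c k z → (ℓ + c * k) * z ≡ ℓ * z + c * (k * z)
    linear-expand = solve-∀
    energy-collect : ∀ z₀ p q Q N ℓ M b B →
      0ℤ * (z₀ * z₀) + z₀ * p + (z₀ * q + Q) + N * (ℓ * z₀ + M) + N * (b + B)
        ≡ (p + q + N * ℓ) * z₀ + N * b + (Q + N * M + N * B)
    energy-collect = solve-∀

  -- The zero diagonal leaves no square of `z₀`, so in that coordinate the energy is affine apart
  -- from the penalty. This is what makes rounding one coordinate possible.
  energy-∷ : ∀ {n} (a : Mat (suc n)) → (∀ u → a u u ≡ 0ℤ) → ∀ ℓ b N z₀ (z : Fin n → ℤ) →
    energy a ℓ b N (z₀ ∷ z)
      ≡ (sum (λ i → (a fz (fs i) + a (fs i) fz) * z i) + N * ℓ fz) * z₀ + N * (b fz * + ∣ z₀ ∣)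
        + energy (λ i j → a (fs i) (fs j)) (λ i → ℓ (fs i)) (λ i → b (fs i)) N z
  energy-∷ a a-diag ℓ b N z₀ z
    rewrite a-diag fz
          | sum-+ (λ i → a (fs i) fz * (z i * z₀)) (λ i → sum λ j → a (fs i) (fs j) * (z i * z j))
          | sum-cong-≗ {x = λ i → a fz (fs i) * (z₀ * z i)} {y = λ i → z₀ * (a fz (fs i) * z i)} (λ i → *-swapˡ (a fz (fs i)) z₀ (z i))
          | sum-cong-≗ {x = λ i → a (fs i) fz * (z i * z₀)} {y = λ i → z₀ * (a (fs i) fz * z i)} (λ i → *-swapʳ (a (fs i) fz) z₀ (z i))
          | sum-cong-≗ {x = λ i → (a fz (fs i) + a (fs i) fz) * z i} {y = λ i → a fz (fs i) * z i + a (fs i) fz * z i} (λ i → ℤ.*-distribʳ-+ (z i) (a fz (fs i)) _)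
          | sum-* z₀ (λ i → a fz (fs i) * z i)
          | sum-* z₀ (λ i → a (fs i) fz * z i)
          | sum-+ (λ i → a fz (fs i) * z i) (λ i → a (fs i) fz * z i)
    = energy-collect z₀ (sum (λ i → a fz (fs i) * z i)) (sum (λ i → a (fs i) fz * z i)) (Q (λ i j → a (fs i) (fs j)) z) N (ℓ fz)
        (sum (λ i → ℓ (fs i) * z i)) (b fz * + ∣ z₀ ∣) (L (λ i → b (fs i)) z)

  -- Once the first coordinate has the value `c`, its products with the others are linear in them
  -- and go into `ℓ`, so the recursion in `minimise` stays within energies.
  energy-shift : ∀ {n} (a : Mat n) (ℓ b : Fin n → ℤ) c (k : Fin n → ℤ) N (z : Fin n → ℤ) →
    energy a (λ u → ℓ u + c * k u) b N z ≡ energy a ℓ b N z + N * (c * sum (λ u → k u * z u))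
  energy-shift a ℓ b c k N z
    rewrite sum-cong-≗ {x = λ u → (ℓ u + c * k u) * z u} {y = λ u → ℓ u * z u + c * (k u * z u)} (λ u → linear-expand (ℓ u) c (k u) (z u))
          | sum-+ (λ u → ℓ u * z u) (λ u → c * (k u * z u))
          | sum-* c (λ u → k u * z u)
    = collect (Q a z) N (sum (λ u → ℓ u * z u)) (c * sum (λ u → k u * z u)) (L b z)
    where
    collect : ∀ q N s t l → q + N * (s + t) + N * l ≡ q + N * s + N * l + N * t
    collect = solve-∀

  -- Minimisation over the cube, one coordinate at a time

  module Minimiser
    (V : Set) (val : V → ℤ)
    (argmin : (f : V → ℤ) → ∃ λ v → ∀ w → f v ≤ f w)
    (Penalty : ℤ → Set)
    -- In one variable: `p z + N β ∣z∣` on `[-N, N]` is never below its value at some `N * val v`;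
    -- `Penalty` says which weights `β` admit this.
    (round : ∀ {β} → Penalty β → ∀ p {N z} → 0ℤ ≤ N → + ∣ z ∣ ≤ N →
       ∃ λ v → N * (p * val v + N * (β * + ∣ val v ∣)) ≤ p * z + N * (β * + ∣ z ∣)) where

    -- Induction on the number of coordinates: for each value of the first one the others are
    -- minimised recursively, and `argmin` keeps the best candidate. It is fixed before `N` and `z`,
    -- so it beats every rational point of the cube at once.
    minimise : ∀ {n} (a : Mat n) → (∀ u → a u u ≡ 0ℤ) → ∀ ℓ b → (∀ u → Penalty (b u)) →
      ∃ λ (s : Fin n → V) → ∀ N z → 0ℤ ≤ N → (∀ u → + ∣ z u ∣ ≤ N) →
        N * N * energy a ℓ b 1ℤ (λ u → val (s u)) ≤ energy a ℓ b N z
    minimise {zero} a _ ℓ b _ = (λ ()) , λ N z _ _ → ℤ.≤-reflexive (zeros N)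
      where
      zeros : ∀ N → N * N * (0ℤ + 1ℤ * 0ℤ + 1ℤ * 0ℤ) ≡ 0ℤ + N * 0ℤ + N * 0ℤ
      zeros = solve-∀
    minimise {suc n} a a-diag ℓ b pen = v⋆ ∷ s v⋆ , bound
      where
      a′ : Mat n
      a′ i j = a (fs i) (fs j)
      ℓ′ b′ k : Fin n → ℤ
      ℓ′ i = ℓ (fs i)
      b′ i = b (fs i)
      k i = a fz (fs i) + a (fs i) fz
      K : (Fin n → ℤ) → ℤ
      K z = sum λ i → k i * z i
      rec : ∀ v → _
      rec v = minimise a′ (λ i → a-diag (fs i)) (λ i → ℓ′ i + val v * k i) b′ (λ i → pen (fs i))
      s : V → Fin n → V
      s v = proj₁ (rec v)
      x : V → Fin n → ℤ
      x v i = val (s v i)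
      f : V → ℤ
      f v = energy a ℓ b 1ℤ (val v ∷ x v)
      v⋆ : V
      v⋆ = proj₁ (argmin f)
      regroup : ∀ N p ℓ v β e → N * N * ((p + 1ℤ * ℓ) * v + 1ℤ * β + e) ≡ N * N * (ℓ * v + β) + N * N * (e + 1ℤ * (v * p))
      regroup = solve-∀
      regroup′ : ∀ N K ℓ v β e → N * N * (ℓ * v + β) + (e + N * (v * K)) ≡ N * ((K + N * ℓ) * v + N * β) + e
      regroup′ = solve-∀
      bound : ∀ N z → 0ℤ ≤ N → (∀ u → + ∣ z u ∣ ≤ N) →
        N * N * f v⋆ ≤ energy a ℓ b N z
      -- Read from the bottom: the head of `z` is rounded to `v` with the tail held fixed, the tail
      -- is replaced by the optimal one for `v`, and finally `v` by `v⋆`.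
      bound N z 0≤N ∣z∣≤N = begin
        N * N * f v⋆
          ≤⟨ *-monoˡ (0≤-* 0≤N 0≤N) (proj₂ (argmin f) v) ⟩
        N * N * f v
          ≡⟨ cong (λ e → N * N * e) (energy-∷ a a-diag ℓ b 1ℤ (val v) (x v)) ⟩
        N * N * ((K (x v) + 1ℤ * ℓ fz) * val v + 1ℤ * β + energy a′ ℓ′ b′ 1ℤ (x v))
          ≡⟨ regroup N (K (x v)) (ℓ fz) (val v) β _ ⟩
        N * N * (ℓ fz * val v + β) + N * N * (energy a′ ℓ′ b′ 1ℤ (x v) + 1ℤ * (val v * K (x v)))
          ≡⟨ cong (λ e → N * N * (ℓ fz * val v + β) + N * N * e) (energy-shift a′ ℓ′ b′ (val v) k 1ℤ (x v)) ⟨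
        N * N * (ℓ fz * val v + β) + N * N * energy a′ (λ i → ℓ′ i + val v * k i) b′ 1ℤ (x v)
          ≤⟨ ℤ.+-monoʳ-≤ (N * N * (ℓ fz * val v + β)) (proj₂ (rec v) N z′ 0≤N (λ i → ∣z∣≤N (fs i))) ⟩
        N * N * (ℓ fz * val v + β) + energy a′ (λ i → ℓ′ i + val v * k i) b′ N z′
          ≡⟨ cong (λ e → N * N * (ℓ fz * val v + β) + e) (energy-shift a′ ℓ′ b′ (val v) k N z′) ⟩
        N * N * (ℓ fz * val v + β) + (energy a′ ℓ′ b′ N z′ + N * (val v * K z′))
          ≡⟨ regroup′ N (K z′) (ℓ fz) (val v) β _ ⟩
        N * ((K z′ + N * ℓ fz) * val v + N * β) + energy a′ ℓ′ b′ N z′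
          ≤⟨ ℤ.+-monoˡ-≤ (energy a′ ℓ′ b′ N z′) (proj₂ rounded) ⟩
        (K z′ + N * ℓ fz) * z fz + N * (b fz * + ∣ z fz ∣) + energy a′ ℓ′ b′ N z′
          ≡⟨ energy-∷ a a-diag ℓ b N (z fz) z′ ⟨
        energy a ℓ b N z ∎
        where
        open ℤ.≤-Reasoning
        z′ : Fin n → ℤ
        z′ i = z (fs i)
        rounded : _
        rounded = round (pen fz) (K z′ + N * ℓ fz) 0≤N (∣z∣≤N fz)
        v : V
        v = proj₁ rounded
        β : ℤ
        β = b fz * + ∣ val v ∣

  -- Rounding the coordinates of a minimiser

  sgn : Bool → ℤ
  sgn false = 1ℤ
  sgn true  = - 1ℤ

  tern : Maybe Bool → ℤ
  tern nothing  = 0ℤ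
  tern (just s) = sgn s

  ∣sgn∣ : ∀ s → + ∣ sgn s ∣ ≡ 1ℤ
  ∣sgn∣ false = refl
  ∣sgn∣ true  = refl

  ∣tern∣≤1 : ∀ v → + ∣ tern v ∣ ≤ 1ℤ
  ∣tern∣≤1 nothing  = 0≤+
  ∣tern∣≤1 (just s) = ℤ.≤-reflexive (∣sgn∣ s)

  argmin-Bool : (f : Bool → ℤ) → ∃ λ v → ∀ w → f v ≤ f w
  argmin-Bool f with ℤ.≤-total (f false) (f true)
  ... | inj₁ h = false , λ { false → ℤ.≤-refl ; true → h }
  ... | inj₂ h = true  , λ { false → h ; true → ℤ.≤-refl }

  argmin-Maybe : (f : Maybe Bool → ℤ) → ∃ λ v → ∀ w → f v ≤ f w
  argmin-Maybe f with argmin-Bool (λ s → f (just s))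
  ... | s , s-min with ℤ.≤-total (f nothing) (f (just s))
  ...   | inj₁ h = nothing , λ { nothing → ℤ.≤-refl ; (just t) → ℤ.≤-trans h (s-min t) }
  ...   | inj₂ h = just s  , λ { nothing → h ; (just t) → s-min t }

  ≤-bound : ∀ {z N} → + ∣ z ∣ ≤ N → 0ℤ ≤ N - z
  ≤-bound {z} h = ℤ.i≤j⇒0≤j-i (ℤ.≤-trans (≤∣∣ z) h)

  -≤-bound : ∀ {z N} → + ∣ z ∣ ≤ N → 0ℤ ≤ z + N
  -≤-bound {z} {N} h = subst (0ℤ ≤_) (flip N z)
    (≤-bound { - z} (subst (λ k → + k ≤ N) (sym (ℤ.∣-i∣≡∣i∣ z)) h))
    where
    flip : ∀ N z → N - (- z) ≡ z + N
    flip = solve-∀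

  -- Without a weight the function is linear, so the end of `[-N, N]` opposite to the sign of the
  -- slope `p` is optimal.
  round-Bool : ∀ {β} → β ≡ 0ℤ → ∀ p {N z} → 0ℤ ≤ N → + ∣ z ∣ ≤ N →
    ∃ λ v → N * (p * sgn v + N * (β * + ∣ sgn v ∣)) ≤ p * z + N * (β * + ∣ z ∣)
  round-Bool refl p {N} {z} _ h with ℤ.≤-total 0ℤ p
  ... | inj₁ 0≤p = true , ≤-by (p * (z + N)) (0≤-* 0≤p (-≤-bound {z} h)) (eq p N z (+ ∣ z ∣))
    where
    eq : ∀ p N z m → p * z + N * (0ℤ * m) - N * (p * - 1ℤ + N * (0ℤ * 1ℤ)) ≡ p * (z + N)
    eq = solve-∀
  ... | inj₂ p≤0 = false , ≤-by ((0ℤ - p) * (N - z)) (0≤-* (ℤ.i≤j⇒0≤j-i p≤0) (≤-bound {z} h)) (eq p N z (+ ∣ z ∣))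
    where
    eq : ∀ p N z m → p * z + N * (0ℤ * m) - N * (p * 1ℤ + N * (0ℤ * 1ℤ)) ≡ (0ℤ - p) * (N - z)
    eq = solve-∀

  -- The function is linear on each of `[-N, 0]` and `[0, N]`. On the half that contains `z` the
  -- sign of the slope decides between the outer end and `0`, the third value.
  round-Maybe : ∀ {β} → ⊤ → ∀ p {N z} → 0ℤ ≤ N → + ∣ z ∣ ≤ N →
    ∃ λ v → N * (p * tern v + N * (β * + ∣ tern v ∣)) ≤ p * z + N * (β * + ∣ z ∣)
  round-Maybe {β} _ p {N} {z} 0≤N h with ℤ.+∣i∣≡i⊎+∣i∣≡-i z
  ... | inj₁ pos with ℤ.≤-total 0ℤ (p + N * β)
  ...   | inj₁ 0≤e = nothing , ≤-by (+ ∣ z ∣ * (p + N * β)) (0≤-* (0≤+ {∣ z ∣}) 0≤e) (trans (cong (λ t → p * t + N * (β * + ∣ z ∣) - N * (p * 0ℤ + N * (β * 0ℤ))) (sym pos)) (eq p N (+ ∣ z ∣) β))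
    where
    eq : ∀ p N z β → p * z + N * (β * z) - N * (p * 0ℤ + N * (β * 0ℤ)) ≡ z * (p + N * β)
    eq = solve-∀
  ...   | inj₂ e≤0 = just false , ≤-by ((0ℤ - (p + N * β)) * (N - + ∣ z ∣)) (0≤-* (ℤ.i≤j⇒0≤j-i e≤0) (ℤ.i≤j⇒0≤j-i h)) (trans (cong (λ t → p * t + N * (β * + ∣ z ∣) - N * (p * 1ℤ + N * (β * 1ℤ))) (sym pos)) (eq p N (+ ∣ z ∣) β))
    where
    eq : ∀ p N z β → p * z + N * (β * z) - N * (p * 1ℤ + N * (β * 1ℤ)) ≡ (0ℤ - (p + N * β)) * (N - z)
    eq = solve-∀
  round-Maybe {β} _ p {N} {z} 0≤N h | inj₂ neg with ℤ.≤-total 0ℤ (N * β - p)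
  ...   | inj₁ 0≤e = nothing , ≤-by (+ ∣ z ∣ * (N * β - p)) (0≤-* (0≤+ {∣ z ∣}) 0≤e) (trans (cong (λ t → p * t + N * (β * + ∣ z ∣) - N * (p * 0ℤ + N * (β * 0ℤ))) z≡) (eq p N (+ ∣ z ∣) β))
    where
    z≡ : z ≡ - (+ ∣ z ∣)
    z≡ = trans (sym (ℤ.neg-involutive z)) (cong -_ (sym neg))
    eq : ∀ p N z β → p * - z + N * (β * z) - N * (p * 0ℤ + N * (β * 0ℤ)) ≡ z * (N * β - p)
    eq = solve-∀
  ...   | inj₂ e≤0 = just true , ≤-by ((0ℤ - (N * β - p)) * (N - + ∣ z ∣)) (0≤-* (ℤ.i≤j⇒0≤j-i e≤0) (ℤ.i≤j⇒0≤j-i h)) (trans (cong (λ t → p * t + N * (β * + ∣ z ∣) - N * (p * - 1ℤ + N * (β * 1ℤ))) z≡) (eq p N (+ ∣ z ∣) β))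
    where
    z≡ : z ≡ - (+ ∣ z ∣)
    z≡ = trans (sym (ℤ.neg-involutive z)) (cong -_ (sym neg))
    eq : ∀ p N z β → p * - z + N * (β * z) - N * (p * - 1ℤ + N * (β * 1ℤ)) ≡ (0ℤ - (N * β - p)) * (N - z)
    eq = solve-∀

  Q-scale : ∀ {n} (a : Mat n) κ x → Q (λ u v → κ * a u v) x ≡ κ * Q a x
  Q-scale a κ x = trans (∑∑-cong λ u v → ℤ.*-assoc κ (a u v) (x u * x v)) (∑∑-* κ (λ u v → a u v * (x u * x v)))

  L-scale : ∀ {n} η b (x : Fin n → ℤ) → L (λ u → η * b u) x ≡ η * L b x
  L-scale η b x = trans (sum-cong-≗ λ u → ℤ.*-assoc η (b u) (+ ∣ x u ∣)) (sum-* η (λ u → b u * + ∣ x u ∣))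

  energy-scale : ∀ {n} (a : Mat n) κ η (b : Fin n → ℤ) N x →
    energy (λ u v → κ * a u v) (λ _ → 0ℤ) (λ u → η * b u) N x ≡ κ * Q a x + N * (η * L b x)
  energy-scale {n} a κ η b N x
    rewrite Q-scale a κ x | L-scale η b x | sum-const n 0ℤ = simp (κ * Q a x) N (+ n) (η * L b x)
    where
    simp : ∀ q N n l → q + N * (n * 0ℤ) + N * l ≡ q + N * l
    simp = solve-∀

  -- An integer vector `z` with bound `N` stands for the point `z / N` of the cube. Quantifying over
  -- `N` keeps the argument in the integers although the later test vectors have denominator `n²`.
  Minimises : ∀ {n} → Mat n → ℤ → ℤ → (Fin n → ℤ) → (Fin n → ℤ) → Set
  Minimises a κ η b x = ∀ N z → 0ℤ ≤ N → (∀ u → + ∣ z u ∣ ≤ N) →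
    N * N * (κ * Q a x + η * L b x) ≤ κ * Q a z + N * (η * L b z)

  module _ {n} (a : Mat n) (a-diag : ∀ u → a u u ≡ 0ℤ) where

    private
      *-diag : ∀ κ u → κ * a u u ≡ 0ℤ
      *-diag κ u = trans (cong (κ *_) (a-diag u)) (ℤ.*-zeroʳ κ)

    ternary-minimiser : ∀ κ η b → ∃ λ (x : Fin n → ℤ) → (∀ u → + ∣ x u ∣ ≤ 1ℤ) × Minimises a κ η b x
    ternary-minimiser κ η b = x , (λ u → ∣tern∣≤1 (s u)) , λ N z 0≤N ∣z∣≤N →
      subst₂ (λ e e′ → N * N * e ≤ e′)
        (trans (energy-scale a κ η b 1ℤ x) (cong (λ l → κ * Q a x + l) (ℤ.*-identityˡ (η * L b x))))
        (energy-scale a κ η b N z)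
        (proj₂ minimum N z 0≤N ∣z∣≤N)
      where
      open Minimiser (Maybe Bool) tern argmin-Maybe (λ _ → ⊤) (λ {β} → round-Maybe {β})
      minimum : _
      minimum = minimise (λ u v → κ * a u v) (*-diag κ) (λ _ → 0ℤ) (λ u → η * b u) (λ _ → tt)
      s : Fin n → Maybe Bool
      s = proj₁ minimum
      x : Fin n → ℤ
      x u = tern (s u)

    -- As the diagonal vanishes, `Q` is affine in each coordinate and its variables can be moved to
    -- the ends of `[-1, 1]`. This turns a fractional cut into a genuine one.
    sign-rounding : ∀ x → (∀ u → + ∣ x u ∣ ≤ 1ℤ) → ∃ λ (s : Fin n → Bool) → Q a (λ u → sgn (s u)) ≤ Q a x
    sign-rounding x ∣x∣≤1 = s , subst₂ _≤_
        (trans (cong (1ℤ * 1ℤ *_) (energy-scale a 1ℤ 0ℤ (λ _ → 0ℤ) 1ℤ (λ u → sgn (s u)))) (simp (Q a (λ u → sgn (s u))) (L (λ _ → 0ℤ) (λ u → sgn (s u)))))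
        (trans (energy-scale a 1ℤ 0ℤ (λ _ → 0ℤ) 1ℤ x) (simp′ (Q a x) (L (λ _ → 0ℤ) x)))
        (proj₂ minimum 1ℤ x 0≤+ ∣x∣≤1)
      where
      open Minimiser Bool sgn argmin-Bool (_≡ 0ℤ) round-Bool
      minimum : _
      minimum = minimise (λ u v → 1ℤ * a u v) (*-diag 1ℤ) (λ _ → 0ℤ) (λ u → 0ℤ * 0ℤ) (λ _ → refl)
      s : Fin n → Bool
      s = proj₁ minimum
      simp : ∀ q l → 1ℤ * 1ℤ * (1ℤ * q + 1ℤ * (0ℤ * l)) ≡ q
      simp = solve-∀
      simp′ : ∀ q l → 1ℤ * q + 1ℤ * (0ℤ * l) ≡ q
      simp′ = solve-∀

  -- Optimality conditions at a minimiser

  -- Multiplying a vector by `1ℤ - δ u` deletes its coordinate `u`. The recursive form lets `sum-δ`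
  -- follow the recursion of `sum`.
  δ : ∀ {n} → Fin n → Fin n → ℤ
  δ fz     fz     = 1ℤ
  δ fz     (fs _) = 0ℤ
  δ (fs _) fz     = 0ℤ
  δ (fs u) (fs v) = δ u v

  sum-δ : ∀ {n} u (f : Fin n → ℤ) → sum (λ v → δ u v * f v) ≡ f u
  sum-δ {suc n} fz f rewrite sum-* 0ℤ (λ v → f (fs v)) = simp (f fz) (sum (λ v → f (fs v)))
    where
    simp : ∀ x s → 1ℤ * x + 0ℤ * s ≡ x
    simp = solve-∀
  sum-δ {suc n} (fs u) f rewrite sum-δ u (λ v → f (fs v)) = simp (f fz) (f (fs u))
    where
    simp : ∀ x s → 0ℤ * x + s ≡ s
    simp = solve-∀

  ∣1-δ∣ : ∀ {n} (u v : Fin n) → + ∣ 1ℤ - δ u v ∣ ≡ 1ℤ - δ u v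
  ∣1-δ∣ fz     fz     = refl
  ∣1-δ∣ fz     (fs _) = refl
  ∣1-δ∣ (fs _) fz     = refl
  ∣1-δ∣ (fs u) (fs v) = ∣1-δ∣ u v

  0≤δ : ∀ {n} (u v : Fin n) → 0ℤ ≤ δ u v
  0≤δ fz     fz     = 0≤+
  0≤δ fz     (fs _) = 0≤+
  0≤δ (fs _) fz     = 0≤+
  0≤δ (fs u) (fs v) = 0≤δ u v

  gram : ∀ {k n} → (Fin k → Fin n → ℤ) → Mat n
  gram f u v = sum λ w → f w u * f w v

  halve : ∀ {i j} → + 2 * i ≤ + 2 * j → i ≤ j
  halve {i} {j} = ℤ.*-cancelˡ-≤-pos i j (+ 2)

  L-zeroed : ∀ {n} (b x : Fin n → ℤ) u → L b (λ v → x v * (1ℤ - δ u v)) ≡ L b x - b u * + ∣ x u ∣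
  L-zeroed b x u = begin
    L b (λ v → x v * (1ℤ - δ u v))
      ≡⟨ sum-cong-≗ (λ v → trans (cong (λ m → b v * m) (trans (∣*∣ (x v) (1ℤ - δ u v)) (cong (λ m → + ∣ x v ∣ * m) (∣1-δ∣ u v)))) (expand (b v) (+ ∣ x v ∣) (δ u v))) ⟩
    sum (λ v → 1ℤ * (b v * + ∣ x v ∣) + - 1ℤ * (δ u v * (b v * + ∣ x v ∣)))
      ≡⟨ sum-lin₂ 1ℤ (- 1ℤ) (λ v → b v * + ∣ x v ∣) (λ v → δ u v * (b v * + ∣ x v ∣)) ⟩
    1ℤ * L b x + - 1ℤ * sum (λ v → δ u v * (b v * + ∣ x v ∣))
      ≡⟨ cong (λ s → 1ℤ * L b x + - 1ℤ * s) (sum-δ u (λ v → b v * + ∣ x v ∣)) ⟩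
    1ℤ * L b x + - 1ℤ * (b u * + ∣ x u ∣)
      ≡⟨ collect (L b x) (b u * + ∣ x u ∣) ⟩
    L b x - b u * + ∣ x u ∣ ∎
    where
    open ≡-Reasoning
    expand : ∀ b m d → b * (m * (1ℤ - d)) ≡ 1ℤ * (b * m) + - 1ℤ * (d * (b * m))
    expand = solve-∀
    collect : ∀ l m → 1ℤ * l + - 1ℤ * m ≡ l - m
    collect = solve-∀

  -- A total of `Q` over a family is linear in the Gram matrix, so totals over all vertices can be
  -- read off from common-neighbour counts.
  ∑Q-gram : ∀ {k n} (a : Mat n) (f : Fin k → Fin n → ℤ) → sum (λ w → Q a (f w)) ≡ ∑∑ (λ u v → a u v * gram f u v)
  ∑Q-gram a f = begin
    sum (λ w → Q a (f w))
      ≡⟨ ∑-comm (λ w u → sum λ v → a u v * (f w u * f w v)) ⟩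
    sum (λ u → sum λ w → sum λ v → a u v * (f w u * f w v))
      ≡⟨ sum-cong-≗ (λ u → ∑-comm (λ w v → a u v * (f w u * f w v))) ⟩
    ∑∑ (λ u v → sum λ w → a u v * (f w u * f w v))
      ≡⟨ ∑∑-cong (λ u v → sum-* (a u v) (λ w → f w u * f w v)) ⟩
    ∑∑ (λ u v → a u v * gram f u v) ∎
    where open ≡-Reasoning

  -- Taking both signs of the perturbation cancels the mixed terms between `x` and `y`.
  Q-parallelogram : ∀ {n} (a : Mat n) x y → Q a (λ u → x u + y u) + Q a (λ u → x u - y u) ≡ + 2 * (Q a x + Q a y)
  Q-parallelogram a x y = begin
    Q a (λ u → x u + y u) + Q a (λ u → x u - y u)
      ≡⟨ unit (Q a (λ u → x u + y u)) (Q a (λ u → x u - y u)) ⟩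
    1ℤ * Q a (λ u → x u + y u) + 1ℤ * Q a (λ u → x u - y u)
      ≡⟨ ∑∑-lin₂ 1ℤ 1ℤ (λ u v → a u v * ((x u + y u) * (x v + y v))) (λ u v → a u v * ((x u - y u) * (x v - y v))) ⟨
    ∑∑ (λ u v → 1ℤ * (a u v * ((x u + y u) * (x v + y v))) + 1ℤ * (a u v * ((x u - y u) * (x v - y v))))
      ≡⟨ ∑∑-cong (λ u v → identity (a u v) (x u) (x v) (y u) (y v)) ⟩
    ∑∑ (λ u v → + 2 * (a u v * (x u * x v)) + + 2 * (a u v * (y u * y v)))
      ≡⟨ ∑∑-lin₂ (+ 2) (+ 2) (λ u v → a u v * (x u * x v)) (λ u v → a u v * (y u * y v)) ⟩
    + 2 * Q a x + + 2 * Q a y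
      ≡⟨ ℤ.*-distribˡ-+ (+ 2) (Q a x) (Q a y) ⟨
    + 2 * (Q a x + Q a y) ∎
    where
    open ≡-Reasoning
    unit : ∀ p q → p + q ≡ 1ℤ * p + 1ℤ * q
    unit = solve-∀
    identity : ∀ a x x′ y y′ → 1ℤ * (a * ((x + y) * (x′ + y′))) + 1ℤ * (a * ((x - y) * (x′ - y′)))
      ≡ + 2 * (a * (x * x′)) + + 2 * (a * (y * y′))
    identity = solve-∀

  module _ {n} (a : Mat n) (a-diag : ∀ u → a u u ≡ 0ℤ) (a-sym : ∀ u v → a u v ≡ a v u) where

    private
      q : (Fin n → ℤ) → Fin n → ℤ
      q x u = sum λ v → a u v * (x u * x v)

    -- Deleting coordinate `u` removes its row and its column, which are equal by symmetry; the
    -- entry they share lies on the diagonal and is zero.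
    Q-zeroed : ∀ x u → Q a (λ v → x v * (1ℤ - δ u v)) ≡ Q a x - + 2 * q x u
    Q-zeroed x u = begin
      Q a (λ v → x v * (1ℤ - δ u v))
        ≡⟨ ∑∑-cong (λ i j → expand (a i j) (x i) (x j) (δ u i) (δ u j)) ⟩
      ∑∑ (λ i j → 1ℤ * f i j + - 1ℤ * (δ u i * f i j) + - 1ℤ * (δ u j * f i j) + 1ℤ * (δ u i * (δ u j * f i j)))
        ≡⟨ ∑∑-lin₄ 1ℤ (- 1ℤ) (- 1ℤ) 1ℤ f (λ i j → δ u i * f i j) (λ i j → δ u j * f i j) (λ i j → δ u i * (δ u j * f i j)) ⟩
      1ℤ * Q a x + - 1ℤ * ∑∑ (λ i j → δ u i * f i j) + - 1ℤ * ∑∑ (λ i j → δ u j * f i j) + 1ℤ * ∑∑ (λ i j → δ u i * (δ u j * f i j))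
        ≡⟨ cong₂ _+_ (cong₂ (λ s t → 1ℤ * Q a x + - 1ℤ * s + - 1ℤ * t) row column) (cong (λ s → 1ℤ * s) corner) ⟩
      1ℤ * Q a x + - 1ℤ * q x u + - 1ℤ * q x u + 1ℤ * 0ℤ
        ≡⟨ collect (Q a x) (q x u) ⟩
      Q a x - + 2 * q x u ∎
      where
      open ≡-Reasoning
      f : Fin n → Fin n → ℤ
      f i j = a i j * (x i * x j)
      expand : ∀ a x y d e → a * (x * (1ℤ - d) * (y * (1ℤ - e))) ≡
        1ℤ * (a * (x * y)) + - 1ℤ * (d * (a * (x * y))) + - 1ℤ * (e * (a * (x * y))) + 1ℤ * (d * (e * (a * (x * y))))
      expand = solve-∀
      collect : ∀ Q q → 1ℤ * Q + - 1ℤ * q + - 1ℤ * q + 1ℤ * 0ℤ ≡ Q - + 2 * q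
      collect = solve-∀
      row : ∑∑ (λ i j → δ u i * f i j) ≡ q x u
      row = trans (sum-cong-≗ λ i → sum-* (δ u i) (f i)) (sum-δ u (λ i → sum (f i)))
      column : ∑∑ (λ i j → δ u j * f i j) ≡ q x u
      column = trans (sum-cong-≗ λ i → sum-δ u (f i))
                     (sum-cong-≗ λ i → cong₂ _*_ (a-sym i u) (ℤ.*-comm (x i) (x u)))
      corner : ∑∑ (λ i j → δ u i * (δ u j * f i j)) ≡ 0ℤ
      corner = trans (sum-cong-≗ λ i → trans (sum-* (δ u i) (λ j → δ u j * f i j)) (cong (λ s → δ u i * s) (sum-δ u (f i))))
                 (trans (sum-δ u (λ i → f i u)) (trans (cong (λ s → s * (x u * x u)) (a-diag u)) (ℤ.*-zeroˡ (x u * x u))))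

    module _ (κ η : ℤ) (0≤κ : 0ℤ ≤ κ) (0≤η : 0ℤ ≤ η) (b : Fin n → ℤ) (0≤b : ∀ u → 0ℤ ≤ b u)
      (x : Fin n → ℤ) (∣x∣≤1 : ∀ u → + ∣ x u ∣ ≤ 1ℤ)
      (x-min : Minimises a κ η b x) where

      -- The left side is the drop of the functional when coordinate `u` of the minimiser is
      -- deleted, and a minimiser admits no positive drop.
      coordinate-optimality : ∀ u → + 2 * (κ * q x u) + η * (b u * + ∣ x u ∣) ≤ 0ℤ
      coordinate-optimality u = ≤-by
        (κ * Q a z + 1ℤ * (η * L b z) - 1ℤ * 1ℤ * (κ * Q a x + η * L b x))
        (ℤ.i≤j⇒0≤j-i (x-min 1ℤ z 0≤+ ∣z∣≤1))
        (trans (identity κ (Q a x) (q x u) η (L b x) (b u * + ∣ x u ∣))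
          (sym (cong₂ (λ s t → κ * s + 1ℤ * (η * t) - 1ℤ * 1ℤ * (κ * Q a x + η * L b x)) (Q-zeroed x u) (L-zeroed b x u))))
        where
        z : Fin n → ℤ
        z v = x v * (1ℤ - δ u v)
        identity : ∀ κ Q q η L m → 0ℤ - (+ 2 * (κ * q) + η * m)
          ≡ κ * (Q - + 2 * q) + 1ℤ * (η * (L - m)) - 1ℤ * 1ℤ * (κ * Q + η * L)
        identity = solve-∀
        split : ∀ m d → 1ℤ - m * (1ℤ - d) ≡ (1ℤ - m) + m * d
        split = solve-∀
        ∣z∣≤1 : ∀ v → + ∣ z v ∣ ≤ 1ℤ
        ∣z∣≤1 v = ≤-by (1ℤ - + ∣ x v ∣ + + ∣ x v ∣ * δ u v)
          (0≤-+ (ℤ.i≤j⇒0≤j-i (∣x∣≤1 v)) (0≤-* (0≤+ {∣ x v ∣}) (0≤δ u v)))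
          (trans (cong (λ s → 1ℤ - s) (trans (∣*∣ (x v) (1ℤ - δ u v)) (cong (λ m → + ∣ x v ∣ * m) (∣1-δ∣ u v)))) (split (+ ∣ x v ∣) (δ u v)))

      -- Sum of the coordinate conditions. It bounds the penalty by a multiple of `- Q a x`.
      optimality : + 2 * (κ * Q a x) + η * L b x ≤ 0ℤ
      optimality = subst₂ _≤_
        (trans (sum-cong-≗ λ u → cong (λ s → s + η * (b u * + ∣ x u ∣)) (sym (ℤ.*-assoc (+ 2) κ (q x u))))
          (trans (sum-lin₂ (+ 2 * κ) η (q x) (λ u → b u * + ∣ x u ∣))
            (cong (λ s → s + η * L b x) (ℤ.*-assoc (+ 2) κ (Q a x)))))
        (trans (sum-const n 0ℤ) (ℤ.*-zeroʳ (+ n)))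
        (sum-mono coordinate-optimality)

      -- The minimiser is compared with the two points `r x ± y` at denominator `N`, and the
      -- inequalities are added. `cube` makes the points admissible, `near` bounds their penalty.
      perturbation : ∀ N → 0ℤ ≤ N → ∀ (r y m : Fin n → ℤ) →
        (∀ u → + ∣ r u ∣ * + ∣ x u ∣ + + ∣ y u ∣ ≤ N) →
        (∀ u → + ∣ r u ∣ * + ∣ x u ∣ + + ∣ y u ∣ ≤ N * + ∣ x u ∣ + m u) →
        N * N * (κ * Q a x + η * L b x)
          ≤ κ * (Q a (λ u → r u * x u) + Q a y) + N * (η * sum (λ u → b u * (N * + ∣ x u ∣ + m u)))
      perturbation N 0≤N r y m cube near = halve (begin
        + 2 * (N * N * (κ * Q a x + η * L b x))
          ≡⟨ double (N * N * (κ * Q a x + η * L b x)) ⟩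
        N * N * (κ * Q a x + η * L b x) + N * N * (κ * Q a x + η * L b x)
          ≤⟨ ℤ.+-mono-≤ (x-min N z⁺ 0≤N (λ u → ℤ.≤-trans (∣z⁺∣ u) (cube u)))
                        (x-min N z⁻ 0≤N (λ u → ℤ.≤-trans (∣z⁻∣ u) (cube u))) ⟩
        (κ * Q a z⁺ + N * (η * L b z⁺)) + (κ * Q a z⁻ + N * (η * L b z⁻))
          ≤⟨ ℤ.+-mono-≤ (ℤ.+-monoʳ-≤ (κ * Q a z⁺) (*-monoˡ 0≤N (*-monoˡ 0≤η (sum-mono λ u → *-monoˡ (0≤b u) (ℤ.≤-trans (∣z⁺∣ u) (near u))))))
                        (ℤ.+-monoʳ-≤ (κ * Q a z⁻) (*-monoˡ 0≤N (*-monoˡ 0≤η (sum-mono λ u → *-monoˡ (0≤b u) (ℤ.≤-trans (∣z⁻∣ u) (near u)))))) ⟩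
        (κ * Q a z⁺ + N * (η * U)) + (κ * Q a z⁻ + N * (η * U))
          ≡⟨ regroup κ (Q a z⁺) (Q a z⁻) (N * (η * U)) ⟩
        κ * (Q a z⁺ + Q a z⁻) + + 2 * (N * (η * U))
          ≡⟨ cong (λ s → κ * s + + 2 * (N * (η * U))) (Q-parallelogram a (λ u → r u * x u) y) ⟩
        κ * (+ 2 * (Q a (λ u → r u * x u) + Q a y)) + + 2 * (N * (η * U))
          ≡⟨ regroup′ κ (Q a (λ u → r u * x u) + Q a y) (N * (η * U)) ⟩
        + 2 * (κ * (Q a (λ u → r u * x u) + Q a y) + N * (η * U)) ∎)
        where
        open ℤ.≤-Reasoning
        z⁺ z⁻ : Fin n → ℤ
        z⁺ u = r u * x u + y u
        z⁻ u = r u * x u - y u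
        U : ℤ
        U = sum (λ u → b u * (N * + ∣ x u ∣ + m u))
        ∣z⁺∣ : ∀ u → + ∣ z⁺ u ∣ ≤ + ∣ r u ∣ * + ∣ x u ∣ + + ∣ y u ∣
        ∣z⁺∣ u = subst (λ s → + ∣ z⁺ u ∣ ≤ s + + ∣ y u ∣) (∣*∣ (r u) (x u)) (∣+∣-≤ (r u * x u) (y u))
        ∣z⁻∣ : ∀ u → + ∣ z⁻ u ∣ ≤ + ∣ r u ∣ * + ∣ x u ∣ + + ∣ y u ∣
        ∣z⁻∣ u = subst (λ s → + ∣ z⁻ u ∣ ≤ s + + ∣ y u ∣) (∣*∣ (r u) (x u)) (∣-∣-≤ (r u * x u) (y u))
        double : ∀ e → + 2 * e ≡ e + e
        double = solve-∀
        regroup : ∀ κ p q u → (κ * p + u) + (κ * q + u) ≡ κ * (p + q) + + 2 * u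
        regroup = solve-∀
        regroup′ : ∀ κ s u → κ * (+ 2 * s) + + 2 * u ≡ + 2 * (κ * s + u)
        regroup′ = solve-∀

  *-cancelˡ : ∀ {k i j} → 0ℤ < k → k * i ≤ k * j → i ≤ j
  *-cancelˡ {k} {i} {j} 0<k = ℤ.*-cancelˡ-≤-pos i j k {{ℤ.positive 0<k}}

  0<-* : ∀ {i j} → 0ℤ < i → 0ℤ < j → 0ℤ < i * j
  0<-* {i} {j} 0<i 0<j = subst (_< i * j) (ℤ.*-zeroʳ i) (ℤ.*-monoˡ-<-pos i {{ℤ.positive 0<i}} 0<j)

  -- For an adjacency entry e the test vector (N - (N e + D)) x ± (N e - D) stays in the cube.
  module _ (N D X : ℤ) (0≤D : 0ℤ ≤ D) (D≤N : D ≤ N) (0≤X : 0ℤ ≤ X) (X≤1 : X ≤ 1ℤ) where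

    private
      0≤N-D : 0ℤ ≤ N - D
      0≤N-D = ℤ.i≤j⇒0≤j-i D≤N
      0≤1-X : 0ℤ ≤ 1ℤ - X
      0≤1-X = ℤ.i≤j⇒0≤j-i X≤1
      ∣pos∣ : ∀ {i j} → i ≡ j → 0ℤ ≤ j → + ∣ i ∣ ≡ j
      ∣pos∣ refl = ℤ.0≤i⇒+∣i∣≡i
      ∣neg∣ : ∀ {i j} → i ≡ - j → 0ℤ ≤ j → + ∣ i ∣ ≡ j
      ∣neg∣ {j = j} refl h = trans (cong +_ (ℤ.∣-i∣≡∣i∣ j)) (ℤ.0≤i⇒+∣i∣≡i h)
      shrink₀ : ∀ N D → N - (N * 0ℤ + D) ≡ N - D
      shrink₀ = solve-∀
      shift₀ : ∀ N D → N * 0ℤ - D ≡ - D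
      shift₀ = solve-∀
      shrink₁ : ∀ N D → N - (N * 1ℤ + D) ≡ - D
      shrink₁ = solve-∀
      shift₁ : ∀ N D → N * 1ℤ - D ≡ N - D
      shift₁ = solve-∀

    test-cube : ∀ e → e ≡ 0ℤ ⊎ e ≡ 1ℤ → + ∣ N - (N * e + D) ∣ * X + + ∣ N * e - D ∣ ≤ N
    test-cube e (inj₁ refl)
      = subst₂ (λ r y → r * X + y ≤ N) (sym (∣pos∣ (shrink₀ N D) 0≤N-D)) (sym (∣neg∣ (shift₀ N D) 0≤D))
          (≤-by ((N - D) * (1ℤ - X)) (0≤-* 0≤N-D 0≤1-X) (eq N D X))
      where
      eq : ∀ N D X → N - ((N - D) * X + D) ≡ (N - D) * (1ℤ - X)
      eq = solve-∀
    test-cube e (inj₂ refl)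
      = subst₂ (λ r y → r * X + y ≤ N) (sym (∣neg∣ (shrink₁ N D) 0≤D)) (sym (∣pos∣ (shift₁ N D) 0≤N-D))
          (≤-by (D * (1ℤ - X)) (0≤-* 0≤D 0≤1-X) (eq N D X))
      where
      eq : ∀ N D X → N - (D * X + (N - D)) ≡ D * (1ℤ - X)
      eq = solve-∀

    -- Supplies the hypothesis `near` of `perturbation`. For `e = 1` the factor `N - (N e + D)` is
    -- `- D`, which is why the two values of `e` are treated separately.
    test-growth : ∀ e → e ≡ 0ℤ ⊎ e ≡ 1ℤ → + ∣ N - (N * e + D) ∣ * X + + ∣ N * e - D ∣ ≤ N * X + (N * e + D)
    test-growth e (inj₁ refl)
      = subst₂ (λ r y → r * X + y ≤ N * X + (N * 0ℤ + D)) (sym (∣pos∣ (shrink₀ N D) 0≤N-D)) (sym (∣neg∣ (shift₀ N D) 0≤D))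
          (≤-by (D * X) (0≤-* 0≤D 0≤X) (eq N D X))
      where
      eq : ∀ N D X → N * X + (N * 0ℤ + D) - ((N - D) * X + D) ≡ D * X
      eq = solve-∀
    test-growth e (inj₂ refl)
      = subst₂ (λ r y → r * X + y ≤ N * X + (N * 1ℤ + D)) (sym (∣neg∣ (shrink₁ N D) 0≤D)) (sym (∣pos∣ (shift₁ N D) 0≤N-D))
          (≤-by ((N - D) * X + (D + D)) (0≤-+ (0≤-* 0≤N-D 0≤X) (0≤-+ 0≤D 0≤D)) (eq N D X))
      where
      eq : ∀ N D X → N * X + (N * 1ℤ + D) - (D * X + (N - D)) ≡ (N - D) * X + (D + D)
      eq = solve-∀

  -- Averages over the neighbourhood vectors of all vertices

  module Core {n} (a : Mat n) (a-diag : ∀ u → a u u ≡ 0ℤ) (a-sym : ∀ u v → a u v ≡ a v u)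
    (a-01 : ∀ u v → a u v ≡ 0ℤ ⊎ a u v ≡ 1ℤ) where

    d : Fin n → ℤ
    d u = sum (a u)

    -- T is six times the number of triangles; N clears the denominator of the mean density D / n².
    D S T N W : ℤ
    D = ∑∑ a
    S = sum λ u → d u * d u
    T = ∑∑ λ u v → a u v * sum λ w → a u w * a v w
    N = + n * + n
    W = D * S

    0≤a : ∀ u v → 0ℤ ≤ a u v
    0≤a u v with a-01 u v
    ... | inj₁ eq rewrite eq = 0≤+
    ... | inj₂ eq rewrite eq = 0≤+

    a≤1 : ∀ u v → a u v ≤ 1ℤ
    a≤1 u v with a-01 u v
    ... | inj₁ eq rewrite eq = 0≤+
    ... | inj₂ eq rewrite eq = ℤ.≤-refl

    0≤d : ∀ u → 0ℤ ≤ d u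
    0≤d u = sum-nonneg (0≤a u)

    0≤D : 0ℤ ≤ D
    0≤D = sum-nonneg 0≤d

    0≤S : 0ℤ ≤ S
    0≤S = sum-nonneg λ u → 0≤-sq (d u)

    0≤T : 0ℤ ≤ T
    0≤T = sum-nonneg λ u → sum-nonneg λ v → 0≤-* (0≤a u v) (sum-nonneg λ w → 0≤-* (0≤a u w) (0≤a v w))

    0≤N : 0ℤ ≤ N
    0≤N = 0≤-* (0≤+ {n}) (0≤+ {n})

    D≤N : D ≤ N
    D≤N = subst (D ≤_) (sum-const n (+ n))
      (sum-mono λ u → subst (d u ≤_) (trans (sum-const n 1ℤ) (ℤ.*-identityʳ (+ n))) (sum-mono (a≤1 u)))

    -- Cauchy-Schwarz in the form `D² ≤ n S`, multiplied by `n D`; the difference is a multiple of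
    -- the variance of the degrees.
    nD³≤NW : + n * (D * D) * D ≤ N * W
    nD³≤NW = ≤-by (D * sum (λ u → (+ n * d u - D) * (+ n * d u - D)))
      (0≤-* 0≤D (sum-nonneg λ u → 0≤-sq (+ n * d u - D)))
      (trans (distribute (+ n) D S) (cong (D *_) (sym variance)))
      where
      distribute : ∀ n D S → n * n * (D * S) - n * (D * D) * D ≡ D * (n * (n * S) - n * (D * D))
      distribute = solve-∀
      expand : ∀ n d D → (n * d - D) * (n * d - D) ≡ n * n * (d * d) + - (+ 2 * n * D) * d + D * D * 1ℤ
      expand = solve-∀
      collect : ∀ n S D → n * n * S + - (+ 2 * n * D) * D + D * D * (n * 1ℤ) ≡ n * (n * S) - n * (D * D)
      collect = solve-∀
      variance : sum (λ u → (+ n * d u - D) * (+ n * d u - D)) ≡ + n * (+ n * S) - + n * (D * D)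
      variance = begin
        sum (λ u → (+ n * d u - D) * (+ n * d u - D))
          ≡⟨ sum-cong-≗ (λ u → expand (+ n) (d u) D) ⟩
        sum (λ u → + n * + n * (d u * d u) + - (+ 2 * + n * D) * d u + D * D * 1ℤ)
          ≡⟨ sum-lin₃ (+ n * + n) (- (+ 2 * + n * D)) (D * D) (λ u → d u * d u) d (λ _ → 1ℤ) ⟩
        + n * + n * S + - (+ 2 * + n * D) * D + D * D * sum {n} (λ _ → 1ℤ)
          ≡⟨ cong (λ s → + n * + n * S + - (+ 2 * + n * D) * D + D * D * s) (sum-const n 1ℤ) ⟩
        + n * + n * S + - (+ 2 * + n * D) * D + D * D * (+ n * 1ℤ)
          ≡⟨ collect (+ n) S D ⟩
        + n * (+ n * S) - + n * (D * D) ∎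
        where open ≡-Reasoning

    affine : ℤ → ℤ → Fin n → Fin n → ℤ
    affine α γ w u = α * a u w + γ

    gram-affine : ∀ α γ u v → gram (affine α γ) u v
      ≡ α * α * sum (λ w → a u w * a v w) + α * γ * (d u + d v) + + n * (γ * γ)
    gram-affine α γ u v = begin
      gram (affine α γ) u v
        ≡⟨ sum-cong-≗ (λ w → expand α γ (a u w) (a v w)) ⟩
      sum (λ w → α * α * (a u w * a v w) + α * γ * a u w + α * γ * a v w + γ * γ * 1ℤ)
        ≡⟨ sum-lin₄ (α * α) (α * γ) (α * γ) (γ * γ) (λ w → a u w * a v w) (a u) (a v) (λ _ → 1ℤ) ⟩
      α * α * k + α * γ * d u + α * γ * d v + γ * γ * sum {n} (λ _ → 1ℤ)
        ≡⟨ cong (λ s → α * α * k + α * γ * d u + α * γ * d v + γ * γ * s) (sum-const n 1ℤ) ⟩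
      α * α * k + α * γ * d u + α * γ * d v + γ * γ * (+ n * 1ℤ)
        ≡⟨ collect α γ k (d u) (d v) (+ n) ⟩
      α * α * k + α * γ * (d u + d v) + + n * (γ * γ) ∎
      where
      open ≡-Reasoning
      k : ℤ
      k = sum λ w → a u w * a v w
      expand : ∀ α γ x y → (α * x + γ) * (α * y + γ) ≡ α * α * (x * y) + α * γ * x + α * γ * y + γ * γ * 1ℤ
      expand = solve-∀
      collect : ∀ α γ k x y n → α * α * k + α * γ * x + α * γ * y + γ * γ * (n * 1ℤ) ≡ α * α * k + α * γ * (x + y) + n * (γ * γ)
      collect = solve-∀

    ∑∑-degree : ∑∑ (λ u v → a u v * d u) ≡ S
    ∑∑-degree = sum-cong-≗ λ u → trans (sum-cong-≗ λ v → ℤ.*-comm (a u v) (d u)) (sum-* (d u) (a u))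

    ∑∑-degree′ : ∑∑ (λ u v → a u v * d v) ≡ S
    ∑∑-degree′ = trans (∑-comm λ u v → a u v * d v)
      (trans (∑∑-cong λ v u → cong (λ s → s * d v) (a-sym u v)) ∑∑-degree)

    -- Paired with the adjacency matrix, the three parts of the Gram matrix count closed walks of
    -- length three, walks of length two, and ordered edges.
    ∑∑-affine : ∀ α γ → ∑∑ (λ u v → a u v * gram (affine α γ) u v)
      ≡ α * α * T + + 2 * (α * γ) * S + + n * (γ * γ) * D
    ∑∑-affine α γ = begin
      ∑∑ (λ u v → a u v * gram (affine α γ) u v)
        ≡⟨ ∑∑-cong (λ u v → trans (cong (λ s → a u v * s) (gram-affine α γ u v)) (expand α γ (a u v) (k u v) (d u) (d v) (+ n))) ⟩
      ∑∑ (λ u v → α * α * (a u v * k u v) + α * γ * (a u v * d u) + α * γ * (a u v * d v) + + n * (γ * γ) * a u v)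
        ≡⟨ ∑∑-lin₄ (α * α) (α * γ) (α * γ) (+ n * (γ * γ)) (λ u v → a u v * k u v) (λ u v → a u v * d u) (λ u v → a u v * d v) a ⟩
      α * α * T + α * γ * ∑∑ (λ u v → a u v * d u) + α * γ * ∑∑ (λ u v → a u v * d v) + + n * (γ * γ) * D
        ≡⟨ cong₂ (λ s t → α * α * T + α * γ * s + α * γ * t + + n * (γ * γ) * D) ∑∑-degree ∑∑-degree′ ⟩
      α * α * T + α * γ * S + α * γ * S + + n * (γ * γ) * D
        ≡⟨ collect α γ T S (+ n) D ⟩
      α * α * T + + 2 * (α * γ) * S + + n * (γ * γ) * D ∎
      where
      open ≡-Reasoning
      k : Fin n → Fin n → ℤ
      k u v = sum λ w → a u w * a v w
      expand : ∀ α γ e k x y n → e * (α * α * k + α * γ * (x + y) + n * (γ * γ))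
        ≡ α * α * (e * k) + α * γ * (e * x) + α * γ * (e * y) + n * (γ * γ) * e
      expand = solve-∀
      collect : ∀ α γ T S n D → α * α * T + α * γ * S + α * γ * S + n * (γ * γ) * D
        ≡ α * α * T + + 2 * (α * γ) * S + n * (γ * γ) * D
      collect = solve-∀

    -- N times the vectors a w + D / n² and a w - D / n² for a vertex w.
    m y : Fin n → Fin n → ℤ
    m = affine N D
    y = affine N (- D)

    m̄ : Fin n → ℤ
    m̄ u = sum λ w → m w u

    m̄-≡ : ∀ u → m̄ u ≡ N * d u + + n * D
    m̄-≡ u = trans (sum-+ (λ w → N * a u w) (λ _ → D)) (cong₂ _+_ (sum-* N (a u)) (sum-const n D))

    -- Row sums of the matrix formed by the terms quadratic in `m`. With these weights, `∣x∣ ≤ 1`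
    -- bounds those terms by `L β x`.
    β : Fin n → ℤ
    β u = sum λ v → a u v * gram m u v

    0≤m : ∀ w u → 0ℤ ≤ m w u
    0≤m w u = 0≤-+ (0≤-* 0≤N (0≤a u w)) 0≤D

    0≤ac : ∀ u v → 0ℤ ≤ a u v * gram m u v
    0≤ac u v = 0≤-* (0≤a u v) (sum-nonneg λ w → 0≤-* (0≤m w u) (0≤m w v))

    0≤β : ∀ u → 0ℤ ≤ β u
    0≤β u = sum-nonneg (0≤ac u)

    -- The total is `N² T - 2 N W + n D³`, and `nD³≤NW` absorbs one of the two copies of `N W`.
    ∑Qy : sum (λ w → Q a (y w)) ≤ 0ℤ - N * (W - N * T)
    ∑Qy = ≤-by (N * W - + n * (D * D) * D) (ℤ.i≤j⇒0≤j-i nD³≤NW)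
      (trans (cong (λ s → 0ℤ - N * (W - N * T) - s) (trans (∑Q-gram a y) (∑∑-affine N (- D))))
        (identity N T S (+ n) D))
      where
      identity : ∀ N T S n D → 0ℤ - N * (D * S - N * T) - (N * N * T + + 2 * (N * - D) * S + n * (- D * - D) * D)
        ≡ N * (D * S) - n * (D * D) * D
      identity = solve-∀

    -- The total is `N² T + 2 N W + n D³`; by `N T ≤ W` and `nD³≤NW` each outer term is at most
    -- `N W`.
    ∑β : 0ℤ ≤ W - N * T → sum β ≤ + 4 * (N * W)
    ∑β 0≤g = ≤-by (N * (W - N * T) + (N * W - + n * (D * D) * D))
      (0≤-+ (0≤-* 0≤N 0≤g) (ℤ.i≤j⇒0≤j-i nD³≤NW))
      (trans (cong (λ s → + 4 * (N * W) - s) (∑∑-affine N D)) (identity N T S (+ n) D))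
      where
      identity : ∀ N T S n D → + 4 * (N * (D * S)) - (N * N * T + + 2 * (N * D) * S + n * (D * D) * D)
        ≡ N * (D * S - N * T) + (N * (D * S) - n * (D * D) * D)
      identity = solve-∀

    -- Summing the perturbation inequality over all vertices

    module _ (M : ℤ) (m̄≤M : ∀ u → m̄ u ≤ M) (x : Fin n → ℤ) (∣x∣≤1 : ∀ u → + ∣ x u ∣ ≤ 1ℤ) where

      q : Fin n → ℤ
      q u = sum λ v → a u v * (x u * x v)

      -- The terms linear in `m w` add up to `- 2 N Σ m̄ u q u`; since every `q u` is nonpositive,
      -- replacing `m̄ u` by `M` only increases this. The quadratic terms are at most `L β x`.
      ∑Qrx : (∀ u → q u ≤ 0ℤ) → sum (λ w → Q a (λ u → (N - m w u) * x u))
        ≤ + n * (N * N) * Q a x - + 2 * (N * M) * Q a x + L β x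
      ∑Qrx q≤0 = begin
        sum (λ w → Q a (λ u → (N - m w u) * x u))
          ≡⟨ ∑Q-gram a (λ w u → (N - m w u) * x u) ⟩
        ∑∑ (λ u v → a u v * gram (λ w u → (N - m w u) * x u) u v)
          ≡⟨ ∑∑-cong (λ u v → trans (cong (λ s → a u v * s) (gram-r u v)) (distribute (+ n) N (a u v) (x u * x v) (m̄ u) (m̄ v) (gram m u v))) ⟩
        ∑∑ (λ u v → + n * (N * N) * f u v + - N * (m̄ u * f u v) + - N * (m̄ v * f u v) + 1ℤ * (a u v * gram m u v * (x u * x v)))
          ≡⟨ ∑∑-lin₄ (+ n * (N * N)) (- N) (- N) 1ℤ f (λ u v → m̄ u * f u v) (λ u v → m̄ v * f u v) (λ u v → a u v * gram m u v * (x u * x v)) ⟩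
        + n * (N * N) * Q a x + - N * ∑∑ (λ u v → m̄ u * f u v) + - N * ∑∑ (λ u v → m̄ v * f u v) + 1ℤ * quadratic
          ≡⟨ cong₂ (λ s t → + n * (N * N) * Q a x + - N * s + - N * t + 1ℤ * quadratic) rows columns ⟩
        + n * (N * N) * Q a x + - N * sum (λ u → m̄ u * q u) + - N * sum (λ u → m̄ u * q u) + 1ℤ * quadratic
          ≤⟨ ≤-by (+ 2 * (N * (sum (λ u → m̄ u * q u) - M * Q a x)) + (L β x - quadratic))
               (0≤-+ (0≤-* (0≤+ {2}) (0≤-* 0≤N (ℤ.i≤j⇒0≤j-i linear))) (ℤ.i≤j⇒0≤j-i quadratic≤))
               (collect (+ n * (N * N) * Q a x) N M (Q a x) (sum (λ u → m̄ u * q u)) (L β x) quadratic) ⟩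
        + n * (N * N) * Q a x - + 2 * (N * M) * Q a x + L β x ∎
        where
        open ℤ.≤-Reasoning
        f : Fin n → Fin n → ℤ
        f u v = a u v * (x u * x v)
        quadratic : ℤ
        quadratic = ∑∑ λ u v → a u v * gram m u v * (x u * x v)
        expand : ∀ N m m′ x x′ → (N - m) * x * ((N - m′) * x′)
          ≡ x * x′ * (N * N) * 1ℤ + - (x * x′ * N) * m + - (x * x′ * N) * m′ + x * x′ * (m * m′)
        expand = solve-∀
        unexpand : ∀ n N e m m′ c → e * (N * N) * (n * 1ℤ) + - (e * N) * m + - (e * N) * m′ + e * c
          ≡ e * (n * (N * N) - N * m - N * m′ + c)
        unexpand = solve-∀
        distribute : ∀ n N a e m m′ c → a * (e * (n * (N * N) - N * m - N * m′ + c))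
          ≡ n * (N * N) * (a * e) + - N * (m * (a * e)) + - N * (m′ * (a * e)) + 1ℤ * (a * c * e)
        distribute = solve-∀
        collect : ∀ z N M Q s l c → z - + 2 * (N * M) * Q + l - (z + - N * s + - N * s + 1ℤ * c)
          ≡ + 2 * (N * (s - M * Q)) + (l - c)
        collect = solve-∀
        gram-r : ∀ u v → gram (λ w u → (N - m w u) * x u) u v
          ≡ x u * x v * (+ n * (N * N) - N * m̄ u - N * m̄ v + gram m u v)
        gram-r u v = trans (sum-cong-≗ λ w → expand N (m w u) (m w v) (x u) (x v))
          (trans (sum-lin₄ (x u * x v * (N * N)) (- (x u * x v * N)) (- (x u * x v * N)) (x u * x v) (λ _ → 1ℤ) (λ w → m w u) (λ w → m w v) (λ w → m w u * m w v))
          (trans (cong (λ s → x u * x v * (N * N) * s + - (x u * x v * N) * m̄ u + - (x u * x v * N) * m̄ v + x u * x v * gram m u v) (sum-const n 1ℤ))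
          (unexpand (+ n) N (x u * x v) (m̄ u) (m̄ v) (gram m u v))))
        rows : ∑∑ (λ u v → m̄ u * f u v) ≡ sum (λ u → m̄ u * q u)
        rows = sum-cong-≗ λ u → sum-* (m̄ u) (f u)
        columns : ∑∑ (λ u v → m̄ v * f u v) ≡ sum (λ u → m̄ u * q u)
        columns = trans (∑-comm λ u v → m̄ v * f u v)
          (trans (∑∑-cong λ v u → cong (λ s → m̄ v * s) (cong₂ _*_ (a-sym u v) (ℤ.*-comm (x u) (x v)))) rows)
        linear : M * Q a x ≤ sum (λ u → m̄ u * q u)
        linear = subst (_≤ sum (λ u → m̄ u * q u)) (sum-* M q)
          (sum-mono λ u → ≤-by ((M - m̄ u) * (0ℤ - q u)) (0≤-* (ℤ.i≤j⇒0≤j-i (m̄≤M u)) (ℤ.i≤j⇒0≤j-i (q≤0 u))) (factor M (m̄ u) (q u)))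
          where
          factor : ∀ M m q → m * q - M * q ≡ (M - m) * (0ℤ - q)
          factor = solve-∀
        xx≤∣x∣ : ∀ u v → x u * x v ≤ + ∣ x u ∣
        xx≤∣x∣ u v = ℤ.≤-trans (≤∣∣ (x u * x v))
          (subst₂ _≤_ (sym (∣*∣ (x u) (x v))) (ℤ.*-identityʳ (+ ∣ x u ∣)) (*-monoˡ (0≤+ {∣ x u ∣}) (∣x∣≤1 v)))
        quadratic≤ : quadratic ≤ L β x
        quadratic≤ = sum-mono λ u → subst (sum (λ v → a u v * gram m u v * (x u * x v)) ≤_)
          (trans (sum-cong-≗ λ v → ℤ.*-comm (a u v * gram m u v) (+ ∣ x u ∣))
            (trans (sum-* (+ ∣ x u ∣) (λ v → a u v * gram m u v)) (ℤ.*-comm (+ ∣ x u ∣) (β u))))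
          (sum-mono λ v → *-monoˡ (0≤ac u v) (xx≤∣x∣ u v))

      ∑growth : sum (λ w → sum λ u → β u * (N * + ∣ x u ∣ + m w u)) ≤ + n * N * L β x + M * sum β
      ∑growth = begin
        sum (λ w → sum λ u → β u * (N * + ∣ x u ∣ + m w u))
          ≡⟨ ∑-comm (λ w u → β u * (N * + ∣ x u ∣ + m w u)) ⟩
        sum (λ u → sum λ w → β u * (N * + ∣ x u ∣ + m w u))
          ≡⟨ sum-cong-≗ (λ u → trans (sum-* (β u) (λ w → N * + ∣ x u ∣ + m w u))
               (cong (λ s → β u * s) (trans (sum-+ (λ _ → N * + ∣ x u ∣) (λ w → m w u)) (cong (λ s → s + m̄ u) (sum-const n (N * + ∣ x u ∣)))))) ⟩
        sum (λ u → β u * (+ n * (N * + ∣ x u ∣) + m̄ u))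
          ≤⟨ sum-mono (λ u → *-monoˡ (0≤β u) (ℤ.+-monoʳ-≤ (+ n * (N * + ∣ x u ∣)) (m̄≤M u))) ⟩
        sum (λ u → β u * (+ n * (N * + ∣ x u ∣) + M))
          ≡⟨ sum-cong-≗ (λ u → expand (β u) (+ n) N (+ ∣ x u ∣) M) ⟩
        sum (λ u → + n * N * (β u * + ∣ x u ∣) + M * β u)
          ≡⟨ sum-lin₂ (+ n * N) M (λ u → β u * + ∣ x u ∣) β ⟩
        + n * N * L β x + M * sum β ∎
        where
        open ℤ.≤-Reasoning
        expand : ∀ b n N x M → b * (n * (N * x) + M) ≡ n * N * (b * x) + M * b
        expand = solve-∀

      module _ (κ η : ℤ) (0<κ : 0ℤ < κ) (0≤η : 0ℤ ≤ η) (x-min : Minimises a κ η β x) where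

        private
          0≤κ : 0ℤ ≤ κ
          0≤κ = ℤ.<⇒≤ 0<κ

        -- Drops the nonnegative penalty from `coordinate-optimality`; this sign is what `∑Qrx` asks
        -- for.
        q≤0 : ∀ u → q u ≤ 0ℤ
        q≤0 u = *-cancelˡ 0<κ (*-cancelˡ {+ 2} (+<+ (ℕ.s≤s ℕ.z≤n)) (begin
          + 2 * (κ * q u)
            ≤⟨ ≤-by (η * (β u * + ∣ x u ∣)) (0≤-* 0≤η (0≤-* (0≤β u) (0≤+ {∣ x u ∣}))) (cancel (+ 2 * (κ * q u)) (η * (β u * + ∣ x u ∣))) ⟩
          + 2 * (κ * q u) + η * (β u * + ∣ x u ∣)
            ≤⟨ coordinate-optimality a a-diag a-sym κ η 0≤κ 0≤η β 0≤β x ∣x∣≤1 x-min u ⟩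
          0ℤ
            ≡⟨ zeros κ ⟩
          + 2 * (κ * 0ℤ) ∎))
          where
          open ℤ.≤-Reasoning
          cancel : ∀ p q → p + q - p ≡ q
          cancel = solve-∀
          zeros : ∀ κ → 0ℤ ≡ + 2 * (κ * 0ℤ)
          zeros = solve-∀

        -- The sum of `perturbation` over all test vertices `w`. The main terms `n N² Q` and
        -- `n N² L` occur on both sides, so what remains sets the gain `N (W - N T)` against the
        -- errors.
        averaged-perturbation :
          + n * (N * N * (κ * Q a x + η * L β x))
            ≤ κ * (+ n * (N * N) * Q a x - + 2 * (N * M) * Q a x + L β x + (0ℤ - N * (W - N * T)))
              + N * (η * (+ n * N * L β x + M * sum β))
        averaged-perturbation = begin
          + n * (N * N * (κ * Q a x + η * L β x))
            ≡⟨ sum-const n (N * N * (κ * Q a x + η * L β x)) ⟨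
          sum {n} (λ _ → N * N * (κ * Q a x + η * L β x))
            ≤⟨ sum-mono (λ w → perturbation a a-diag a-sym κ η 0≤κ 0≤η β 0≤β x ∣x∣≤1 x-min N 0≤N (λ u → N - m w u) (y w) (m w)
                 (λ u → test-cube N D (+ ∣ x u ∣) 0≤D D≤N (0≤+ {∣ x u ∣}) (∣x∣≤1 u) (a u w) (a-01 u w))
                 (λ u → test-growth N D (+ ∣ x u ∣) 0≤D D≤N (0≤+ {∣ x u ∣}) (∣x∣≤1 u) (a u w) (a-01 u w))) ⟩
          sum (λ w → κ * (Qrx w + Q a (y w)) + N * (η * U w))
            ≡⟨ sum-lin₂ κ N (λ w → Qrx w + Q a (y w)) (λ w → η * U w) ⟩
          κ * sum (λ w → Qrx w + Q a (y w)) + N * sum (λ w → η * U w)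
            ≡⟨ cong₂ (λ s t → κ * s + N * t) (sum-+ Qrx (λ w → Q a (y w))) (sum-* η U) ⟩
          κ * (sum Qrx + sum (λ w → Q a (y w))) + N * (η * sum U)
            ≤⟨ ℤ.+-mono-≤ (*-monoˡ 0≤κ (ℤ.+-mono-≤ (∑Qrx q≤0) ∑Qy)) (*-monoˡ 0≤N (*-monoˡ 0≤η ∑growth)) ⟩
          κ * (+ n * (N * N) * Q a x - + 2 * (N * M) * Q a x + L β x + (0ℤ - N * (W - N * T)))
              + N * (η * (+ n * N * L β x + M * sum β)) ∎
          where
          open ℤ.≤-Reasoning
          Qrx U : Fin n → ℤ
          Qrx w = Q a (λ u → (N - m w u) * x u)
          U w = sum λ u → β u * (N * + ∣ x u ∣ + m w u)

    -- With κ = 8NMW and η = g the penalty term NηMb costs at most half of the gain κNg.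
    combine : ∀ {k N M W g q l b} → 0ℤ < N → 0ℤ < M → 0ℤ < W → 0ℤ ≤ g → g ≤ W → 0ℤ ≤ l → b ≤ + 4 * (N * W) →
      k * (N * N * (+ 8 * (N * M * W) * q + g * l))
        ≤ + 8 * (N * M * W) * (k * (N * N) * q - + 2 * (N * M) * q + l + (0ℤ - N * g)) + N * (g * (k * N * l + M * b)) →
      + 2 * (+ 8 * (N * M * W) * q) + g * l ≤ 0ℤ →
      g * g ≤ + 36 * (M * W) * (0ℤ - q)
    -- Here `36 = 4 + 32`: by `g ≤ W` the term `4 g M (- q)` of `main` is at most `4 M W (- q)`.
    combine {k} {N} {M} {W} {g} {q} {l} {b} 0<N 0<M 0<W 0≤g g≤W 0≤l b≤ averaged optimal = ≤-by
      (+ 4 * M * (0ℤ - q) * (W - g) + (+ 4 * g * M * (0ℤ - q) + + 32 * M * W * (0ℤ - q) - g * g))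
      (0≤-+ (0≤-* (0≤-* (0≤-* (0≤+ {4}) 0≤M) 0≤-q) (ℤ.i≤j⇒0≤j-i g≤W)) (ℤ.i≤j⇒0≤j-i main))
      (split g M W q)
      where
      κ : ℤ
      κ = + 8 * (N * M * W)
      0≤M : 0ℤ ≤ M
      0≤M = ℤ.<⇒≤ 0<M
      0<κ : 0ℤ < κ
      0<κ = 0<-* {+ 8} (+<+ (ℕ.s≤s ℕ.z≤n)) (0<-* (0<-* 0<N 0<M) 0<W)
      0≤κ : 0ℤ ≤ κ
      0≤κ = ℤ.<⇒≤ 0<κ
      split : ∀ g M W q → + 36 * (M * W) * (0ℤ - q) - g * g
        ≡ + 4 * M * (0ℤ - q) * (W - g) + (+ 4 * g * M * (0ℤ - q) + + 32 * M * W * (0ℤ - q) - g * g)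
      split = solve-∀
      0≤-q : 0ℤ ≤ 0ℤ - q
      0≤-q = *-cancelˡ 0<κ (*-cancelˡ {+ 2} (+<+ (ℕ.s≤s ℕ.z≤n)) (≤-by
        (0ℤ - (+ 2 * (κ * q) + g * l) + g * l)
        (0≤-+ (ℤ.i≤j⇒0≤j-i optimal) (0≤-* 0≤g 0≤l))
        (eq κ q (g * l))))
        where
        eq : ∀ κ q e → + 2 * (κ * (0ℤ - q)) - + 2 * (κ * 0ℤ) ≡ 0ℤ - (+ 2 * (κ * q) + e) + e
        eq = solve-∀
      eq : ∀ k N M W g q l b →
        + 8 * (N * M * W) * N * (+ 4 * g * M * (0ℤ - q) + + 32 * M * W * (0ℤ - q)) - + 8 * (N * M * W) * N * (g * g)
          ≡ + 2 * g * (+ 8 * (N * M * W) * (k * (N * N) * q - + 2 * (N * M) * q + l + (0ℤ - N * g)) + N * (g * (k * N * l + M * b))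
                - k * (N * N * (+ 8 * (N * M * W) * q + g * l)))
            + + 2 * (+ 8 * (N * M * W)) * (0ℤ - (+ 2 * (+ 8 * (N * M * W) * q) + g * l))
            + + 2 * (N * (g * g) * M) * (+ 4 * (N * W) - b)
      eq = solve-∀
      -- After cancellation `averaged` reads `κ N g ≤ 2 κ N M (- q) + κ l + N M g b`, and
      -- `b ≤ 4 N W` makes the last term at most `κ N g / 2`. Multiplying by `2 g` and bounding
      -- `g l` by `2 κ (- q)` through `optimal` gives the claim times `κ N`.
      main : g * g ≤ + 4 * g * M * (0ℤ - q) + + 32 * M * W * (0ℤ - q)
      main = *-cancelˡ (0<-* 0<κ 0<N) (≤-by _
        (0≤-+ (0≤-+ (0≤-* (0≤-* (0≤+ {2}) 0≤g) (ℤ.i≤j⇒0≤j-i averaged)) (0≤-* (0≤-* (0≤+ {2}) 0≤κ) (ℤ.i≤j⇒0≤j-i optimal)))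
              (0≤-* (0≤-* (0≤+ {2}) (0≤-* (0≤-* (ℤ.<⇒≤ 0<N) (0≤-* 0≤g 0≤g)) 0≤M)) (ℤ.i≤j⇒0≤j-i b≤)))
        (eq k N M W g q l b))

    -- A positive gap forces `W`, hence `κ`, to be positive, and then the ternary minimiser of
    -- `κ Q + g L` meets all hypotheses of `combine`.
    fractional-cut : 0ℤ < N → 0ℤ < W - N * T → ∀ M → 0ℤ < M → (∀ u → m̄ u ≤ M) →
      ∃ λ (x : Fin n → ℤ) → (∀ u → + ∣ x u ∣ ≤ 1ℤ) ×
        (W - N * T) * (W - N * T) ≤ + 36 * (M * W) * (0ℤ - Q a x)
    fractional-cut 0<N 0<g M 0<M m̄≤M = x , ∣x∣≤1 ,
      combine {+ n} {N} {M} {W} {g} {Q a x} {L β x} {sum β} 0<N 0<M 0<W 0≤g g≤W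
        (sum-nonneg λ u → 0≤-* (0≤β u) (0≤+ {∣ x u ∣})) (∑β 0≤g)
        (averaged-perturbation M m̄≤M x ∣x∣≤1 κ g 0<κ 0≤g x-min)
        (optimality a a-diag a-sym κ g (ℤ.<⇒≤ 0<κ) 0≤g β 0≤β x ∣x∣≤1 x-min)
      where
      g κ : ℤ
      g = W - N * T
      κ = + 8 * (N * M * W)
      0≤g : 0ℤ ≤ g
      0≤g = ℤ.<⇒≤ 0<g
      g≤W : g ≤ W
      g≤W = ≤-by (N * T) (0≤-* 0≤N 0≤T) (cancel W (N * T))
        where
        cancel : ∀ w t → w - (w - t) ≡ t
        cancel = solve-∀
      0<W : 0ℤ < W
      0<W = ℤ.<-≤-trans 0<g g≤W
      0<κ : 0ℤ < κ
      0<κ = 0<-* {+ 8} (+<+ (ℕ.s≤s ℕ.z≤n)) (0<-* (0<-* 0<N 0<M) 0<W)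
      minimum : _
      minimum = ternary-minimiser a a-diag κ g β
      x : Fin n → ℤ
      x = proj₁ minimum
      ∣x∣≤1 : ∀ u → + ∣ x u ∣ ≤ 1ℤ
      ∣x∣≤1 = proj₁ (proj₂ minimum)
      x-min : Minimises a κ g β x
      x-min = proj₂ (proj₂ minimum)

  -- Graph parameters as integer sums

  +-sumFin : ∀ {n} (f : Fin n → ℕ) → + sumFin f ≡ sum (λ u → + f u)
  +-sumFin {zero}  f = refl
  +-sumFin {suc n} f = trans (ℤ.pos-+ (f fz) (sumFin λ u → f (fs u))) (cong (λ s → + f fz + s) (+-sumFin λ u → f (fs u)))

  +-sumFin₂ : ∀ {m n} (f : Fin m → Fin n → ℕ) → + sumFin (λ u → sumFin (f u)) ≡ ∑∑ (λ u v → + f u v)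
  +-sumFin₂ f = trans (+-sumFin λ u → sumFin (f u)) (sum-cong-≗ λ u → +-sumFin (f u))

  sumFin-cong : ∀ {n} {f g : Fin n → ℕ} → (∀ u → f u ≡ g u) → sumFin f ≡ sumFin g
  sumFin-cong {zero}  h = refl
  sumFin-cong {suc n} h = cong₂ ℕ._+_ (h fz) (sumFin-cong λ u → h (fs u))

  <ᵇ-connex : ∀ m n → m ≢ n → (n <ᵇ m) ≡ not (m <ᵇ n)
  <ᵇ-connex zero    zero    m≢n = ⊥-elim (m≢n refl)
  <ᵇ-connex zero    (suc n) m≢n = refl
  <ᵇ-connex (suc m) zero    m≢n = refl
  <ᵇ-connex (suc m) (suc n) m≢n = <ᵇ-connex m n (λ eq → m≢n (cong suc eq))

  max-≥ : ∀ {A : Set} (f : A → ℕ) {k} {xs : List A} → Any (λ x → k ≡ f x) xs → k ℕ.≤ foldr _⊔_ 0 (map f xs)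
  max-≥ f {xs = x ∷ˡ xs} (here refl) = ℕ.m≤m⊔n (f x) (foldr _⊔_ 0 (map f xs))
  max-≥ f {xs = x ∷ˡ xs} (there any) = ℕ.≤-trans (max-≥ f any) (ℕ.m≤n⊔m (f x) (foldr _⊔_ 0 (map f xs)))

  -- Partitions are matched pointwise, as functions with equal values need not be equal terms;
  -- `cut≤mc` carries this through `cut` by congruence of sums.
  allParts-complete : ∀ {n} (S : Fin n → Bool) → Any (λ S′ → ∀ u → S u ≡ S′ u) (allParts n)
  allParts-complete {zero}  S = here λ ()
  allParts-complete {suc n} S = concatMap⁺ (λ S → (false ∷ S) ∷ˡ (true ∷ S) ∷ˡ []) (Any.map extend (allParts-complete λ u → S (fs u)))
    where
    extend : ∀ {S′ : Fin n → Bool} → (∀ u → S (fs u) ≡ S′ u) →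
      Any (λ T → ∀ u → S u ≡ T u) ((false ∷ S′) ∷ˡ (true ∷ S′) ∷ˡ [])
    extend h with S fz in eq
    ... | false = here λ { fz → eq ; (fs u) → h u }
    ... | true  = there (here λ { fz → eq ; (fs u) → h u })

  argmax : ∀ {n} (f : Fin (suc n) → ℕ) → ∃ λ u → ∀ v → f v ℕ.≤ f u
  argmax {zero}  f = fz , λ { fz → ℕ.≤-refl }
  argmax {suc n} f with argmax (λ u → f (fs u))
  ... | u , u-max with ℕ.≤-total (f fz) (f (fs u))
  ...   | inj₁ h = fs u , λ { fz → h ; (fs v) → u-max v }
  ...   | inj₂ h = fz , λ { fz → ℕ.≤-refl ; (fs v) → ℕ.≤-trans (u-max v) h }

  -- x, y, z say whether u < v, v < w, u < w; as transitivity is not used, several of the six orderings may hold at once.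
  orders-cover : ∀ x y z → 1ℤ ≤
    + ind (x ∧ y) + + ind (z ∧ not y) + + ind (not x ∧ z) + + ind (y ∧ not z) + + ind (not z ∧ x) + + ind (not y ∧ not x)
  orders-cover true  true  true  = +≤+ (ℕ.s≤s ℕ.z≤n)
  orders-cover true  true  false = +≤+ (ℕ.s≤s ℕ.z≤n)
  orders-cover true  false true  = +≤+ (ℕ.s≤s ℕ.z≤n)
  orders-cover true  false false = +≤+ (ℕ.s≤s ℕ.z≤n)
  orders-cover false true  true  = +≤+ (ℕ.s≤s ℕ.z≤n)
  orders-cover false true  false = +≤+ (ℕ.s≤s ℕ.z≤n)
  orders-cover false false true  = +≤+ (ℕ.s≤s ℕ.z≤n)
  orders-cover false false false = +≤+ (ℕ.s≤s ℕ.z≤n)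

  ∑∑∑ : ∀ {n} → (Fin n → Fin n → Fin n → ℤ) → ℤ
  ∑∑∑ f = sum λ u → ∑∑ (f u)

  swap₁₂ : ∀ {n} (f : Fin n → Fin n → Fin n → ℤ) → ∑∑∑ (λ u v w → f v u w) ≡ ∑∑∑ f
  swap₁₂ f = ∑-comm λ u v → sum (f v u)

  swap₂₃ : ∀ {n} (f : Fin n → Fin n → Fin n → ℤ) → ∑∑∑ (λ u v w → f u w v) ≡ ∑∑∑ f
  swap₂₃ f = sum-cong-≗ λ u → ∑-comm λ v w → f u w v

  ∑∑∑-+ : ∀ {n} (f g : Fin n → Fin n → Fin n → ℤ) → ∑∑∑ (λ u v w → f u v w + g u v w) ≡ ∑∑∑ f + ∑∑∑ g
  ∑∑∑-+ f g = trans (sum-cong-≗ λ u → trans (sum-cong-≗ λ v → sum-+ (f u v) (g u v)) (sum-+ (λ v → sum (f u v)) (λ v → sum (g u v))))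
    (sum-+ (λ u → ∑∑ (f u)) (λ u → ∑∑ (g u)))

  -- Reordering the summation variables does not change the sum, and the transpositions `swap₁₂` and
  -- `swap₂₃` generate all six orders.
  ∑∑∑-symmetrise : ∀ {n} (f : Fin n → Fin n → Fin n → ℤ) →
    ∑∑∑ (λ u v w → f u v w + f u w v + f v u w + f v w u + f w u v + f w v u) ≡ + 6 * ∑∑∑ f
  ∑∑∑-symmetrise f = begin
    ∑∑∑ (λ u v w → f u v w + f u w v + f v u w + f v w u + f w u v + f w v u)
      ≡⟨ ∑∑∑-+ (λ u v w → f u v w + f u w v + f v u w + f v w u + f w u v) (λ u v w → f w v u) ⟩
    ∑∑∑ (λ u v w → f u v w + f u w v + f v u w + f v w u + f w u v) + ∑∑∑ (λ u v w → f w v u)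
      ≡⟨ cong₂ _+_ (∑∑∑-+ (λ u v w → f u v w + f u w v + f v u w + f v w u) (λ u v w → f w u v)) reverse ⟩
    ∑∑∑ (λ u v w → f u v w + f u w v + f v u w + f v w u) + ∑∑∑ (λ u v w → f w u v) + t
      ≡⟨ cong (λ s → s + t) (cong₂ _+_ (∑∑∑-+ (λ u v w → f u v w + f u w v + f v u w) (λ u v w → f v w u)) rotate) ⟩
    ∑∑∑ (λ u v w → f u v w + f u w v + f v u w) + ∑∑∑ (λ u v w → f v w u) + t + t
      ≡⟨ cong (λ s → s + t + t) (cong₂ _+_ (∑∑∑-+ (λ u v w → f u v w + f u w v) (λ u v w → f v u w)) rotate′) ⟩
    ∑∑∑ (λ u v w → f u v w + f u w v) + ∑∑∑ (λ u v w → f v u w) + t + t + t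
      ≡⟨ cong (λ s → s + t + t + t) (cong₂ _+_ (∑∑∑-+ f (λ u v w → f u w v)) (swap₁₂ f)) ⟩
    t + ∑∑∑ (λ u v w → f u w v) + t + t + t + t
      ≡⟨ cong (λ s → t + s + t + t + t + t) (swap₂₃ f) ⟩
    t + t + t + t + t + t
      ≡⟨ six t ⟩
    + 6 * t ∎
    where
    open ≡-Reasoning
    t : ℤ
    t = ∑∑∑ f
    rotate : ∑∑∑ (λ u v w → f w u v) ≡ t
    rotate = trans (swap₂₃ λ u w v → f w u v) (swap₁₂ f)
    rotate′ : ∑∑∑ (λ u v w → f v w u) ≡ t
    rotate′ = trans (swap₁₂ λ v u w → f v w u) (swap₂₃ f)
    reverse : ∑∑∑ (λ u v w → f w v u) ≡ t
    reverse = trans (swap₁₂ λ v u w → f w v u) rotate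
    six : ∀ t → t + t + t + t + t + t ≡ + 6 * t
    six = solve-∀

  -- Cuts and triangles of a graph

  module GraphSums {n} (G : Graph n) where

    a : Mat n
    a u v = + ind (adj G u v)

    a-diag : ∀ u → a u u ≡ 0ℤ
    a-diag u = cong (λ e → + ind e) (irrefl G u)

    a-sym : ∀ u v → a u v ≡ a v u
    a-sym u v = cong (λ e → + ind e) (Graph.sym G u v)

    a-01 : ∀ u v → a u v ≡ 0ℤ ⊎ a u v ≡ 1ℤ
    a-01 u v with adj G u v
    ... | false = inj₁ refl
    ... | true  = inj₂ refl

    open Core a a-diag a-sym a-01 public

    d-≡ : ∀ u → d u ≡ + deg G u
    d-≡ u = sym (+-sumFin λ v → ind (adj G u v))

    D-≡ : D ≡ + sumDeg G
    D-≡ = sym (+-sumFin₂ λ u v → ind (adj G u v))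

    S-≡ : S ≡ + sumDegSq G
    S-≡ = sym (trans (+-sumFin λ u → deg G u ℕ.* deg G u)
      (sum-cong-≗ λ u → trans (ℤ.pos-* (deg G u) (deg G u)) (sym (cong₂ _*_ (d-≡ u) (d-≡ u)))))

    -- Adjacent vertices are distinct by irreflexivity, so exactly one of the two comparisons holds.
    lt-connex : ∀ u v → adj G u v ≡ true → lt v u ≡ not (lt u v)
    lt-connex u v uv = <ᵇ-connex (toℕ u) (toℕ v) λ eq → contra (toℕ-injective eq)
      where
      contra : u ≢ v
      contra refl with trans (sym uv) (irrefl G u)
      ... | ()

    cut≤mc : ∀ S → cut G S ℕ.≤ mc G
    cut≤mc S = max-≥ (cut G) (Any.map (λ h → sumFin-cong λ u → sumFin-cong λ v →
      cong₂ (λ s t → ind (lt u v ∧ adj G u v ∧ (s xor t))) (h u) (h v)) (allParts-complete S))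

    -- Each edge occurs twice in `Q`, with value `1` inside a part and `-1` across, so `- Q` is
    -- twice the excess of crossing over non-crossing edges.
    Q-cut : ∀ S → 0ℤ - Q a (λ u → sgn (S u)) ≡ + 4 * + cut G S - + 2 * + edges G
    Q-cut S = begin
      0ℤ - Q a (λ u → sgn (S u))
        ≡⟨ cong (λ s → 0ℤ - s) (∑∑-cong pointwise) ⟩
      0ℤ - ∑∑ (λ u v → 1ℤ * e u v + 1ℤ * e v u + - + 2 * c u v + - + 2 * c v u)
        ≡⟨ cong (λ s → 0ℤ - s) (∑∑-lin₄ 1ℤ 1ℤ (- + 2) (- + 2) e (λ u v → e v u) c (λ u v → c v u)) ⟩
      0ℤ - (1ℤ * ∑∑ e + 1ℤ * ∑∑ (λ u v → e v u) + - + 2 * ∑∑ c + - + 2 * ∑∑ (λ u v → c v u))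
        ≡⟨ cong₂ (λ s t → 0ℤ - (1ℤ * ∑∑ e + 1ℤ * s + - + 2 * ∑∑ c + - + 2 * t)) (∑-comm λ u v → e v u) (∑-comm λ u v → c v u) ⟩
      0ℤ - (1ℤ * ∑∑ e + 1ℤ * ∑∑ e + - + 2 * ∑∑ c + - + 2 * ∑∑ c)
        ≡⟨ collect (∑∑ e) (∑∑ c) ⟩
      + 4 * ∑∑ c - + 2 * ∑∑ e
        ≡⟨ cong₂ (λ s t → + 4 * s - + 2 * t) (+-sumFin₂ λ u v → ind (lt u v ∧ adj G u v ∧ (S u xor S v))) (+-sumFin₂ λ u v → ind (lt u v ∧ adj G u v)) ⟨
      + 4 * + cut G S - + 2 * + edges G ∎
      where
      open ≡-Reasoning
      e c : Fin n → Fin n → ℤ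
      e u v = + ind (lt u v ∧ adj G u v)
      c u v = + ind (lt u v ∧ adj G u v ∧ (S u xor S v))
      collect : ∀ e c → 0ℤ - (1ℤ * e + 1ℤ * e + - + 2 * c + - + 2 * c) ≡ + 4 * c - + 2 * e
      collect = solve-∀
      table : ∀ x s t → 1ℤ * (sgn s * sgn t)
        ≡ 1ℤ * + ind (x ∧ true) + 1ℤ * + ind (not x ∧ true) + - + 2 * + ind (x ∧ true ∧ (s xor t)) + - + 2 * + ind (not x ∧ true ∧ (t xor s))
      table false false false = refl
      table false false true  = refl
      table false true  false = refl
      table false true  true  = refl
      table true  false false = refl
      table true  false true  = refl
      table true  true  false = refl
      table true  true  true  = refl
      table₀ : ∀ x y s t z → 0ℤ * z
        ≡ 1ℤ * + ind (x ∧ false) + 1ℤ * + ind (y ∧ false) + - + 2 * + ind (x ∧ false ∧ s) + - + 2 * + ind (y ∧ false ∧ t)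
      table₀ false false _ _ z = ℤ.*-zeroˡ z
      table₀ false true  _ _ z = ℤ.*-zeroˡ z
      table₀ true  false _ _ z = ℤ.*-zeroˡ z
      table₀ true  true  _ _ z = ℤ.*-zeroˡ z
      pointwise : ∀ u v → a u v * (sgn (S u) * sgn (S v)) ≡ 1ℤ * e u v + 1ℤ * e v u + - + 2 * c u v + - + 2 * c v u
      pointwise u v with adj G u v in uv | adj G v u in vu
      ... | true  | true  rewrite lt-connex u v uv = table (lt u v) (S u) (S v)
      ... | false | false = table₀ (lt u v) (lt v u) (S u xor S v) (S v xor S u) (sgn (S u) * sgn (S v))
      ... | true  | false with trans (sym uv) (trans (Graph.sym G u v) vu)
      ...   | ()
      pointwise u v | false | true with trans (sym uv) (trans (Graph.sym G u v) vu)
      ...   | ()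

    -- `T` runs over ordered triples while `triangles` counts increasing ones; every ordered
    -- triangle is increasing in at least one of its six rearrangements.
    T≤6triangles : T ≤ + 6 * + triangles G
    T≤6triangles = begin
      T
        ≡⟨ ∑∑-cong (λ u v → sum-* (a u v) (λ w → a u w * a v w)) ⟨
      ∑∑∑ (λ u v w → a u v * (a u w * a v w))
        ≤⟨ sum-mono (λ u → sum-mono λ v → sum-mono λ w → pointwise u v w) ⟩
      ∑∑∑ (λ u v w → o u v w + o u w v + o v u w + o v w u + o w u v + o w v u)
        ≡⟨ ∑∑∑-symmetrise o ⟩
      + 6 * ∑∑∑ o
        ≡⟨ cong (λ s → + 6 * s) (trans (+-sumFin λ u → sumFin λ v → sumFin (oℕ u v)) (sum-cong-≗ λ u → +-sumFin₂ (oℕ u))) ⟨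
      + 6 * + triangles G ∎
      where
      open ℤ.≤-Reasoning
      oℕ : Fin n → Fin n → Fin n → ℕ
      oℕ u v w = ind (lt u v ∧ lt v w ∧ adj G u v ∧ adj G v w ∧ adj G u w)
      o : Fin n → Fin n → Fin n → ℤ
      o u v w = + oℕ u v w
      0≤o : ∀ u v w → 0ℤ ≤ o u v w + o u w v + o v u w + o v w u + o w u v + o w v u
      0≤o u v w = 0≤+
      product≤ : ∀ p q r k → (p ≡ true → q ≡ true → r ≡ true → 1ℤ ≤ k) → 0ℤ ≤ k →
        + ind p * (+ ind q * + ind r) ≤ k
      product≤ true true true k h _ = h refl refl refl
      product≤ true true false k _ h = h
      product≤ true false r k _ h = subst (_≤ k) (cong (1ℤ *_) (sym (ℤ.*-zeroˡ (+ ind r)))) h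
      product≤ false q r k _ h = subst (_≤ k) (sym (ℤ.*-zeroˡ (+ ind q * + ind r))) h
      ∧-true : ∀ x y {p q r} → p ≡ true → q ≡ true → r ≡ true → (x ∧ y ∧ p ∧ q ∧ r) ≡ (x ∧ y)
      ∧-true true  true  refl refl refl = refl
      ∧-true true  false refl refl refl = refl
      ∧-true false _     refl refl refl = refl
      pointwise : ∀ u v w → a u v * (a u w * a v w) ≤ o u v w + o u w v + o v u w + o v w u + o w u v + o w v u
      pointwise u v w = product≤ (adj G u v) (adj G u w) (adj G v w) _ covered (0≤o u v w)
        where
        covered : adj G u v ≡ true → adj G u w ≡ true → adj G v w ≡ true →
          1ℤ ≤ o u v w + o u w v + o v u w + o v w u + o w u v + o w v u
        covered uv uw vw
          -- With all edges present only order tests remain in the six terms; the last three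
          -- rewrites turn reversed tests into negations, as `orders-cover` expects.
          rewrite ∧-true (lt u v) (lt v w) uv vw uw
                | ∧-true (lt u w) (lt w v) uw (trans (Graph.sym G w v) vw) uv
                | ∧-true (lt v u) (lt u w) (trans (Graph.sym G v u) uv) uw vw
                | ∧-true (lt v w) (lt w u) vw (trans (Graph.sym G w u) uw) (trans (Graph.sym G v u) uv)
                | ∧-true (lt w u) (lt u v) (trans (Graph.sym G w u) uw) uv (trans (Graph.sym G w v) vw)
                | ∧-true (lt w v) (lt v u) (trans (Graph.sym G w v) vw) (trans (Graph.sym G v u) uv) (trans (Graph.sym G w u) uw)
                | lt-connex u v uv | lt-connex u w uw | lt-connex v w vw
          = orders-cover (lt u v) (lt v w) (lt u w)

    deficit : ℤ
    deficit = W - N * (+ 6 * + triangles G)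

    deficit≤W : deficit ≤ W
    deficit≤W = ≤-by (N * (+ 6 * + triangles G)) (0≤-* 0≤N (0≤-* (0≤+ {6}) (0≤+ {triangles G}))) (cancel W (N * (+ 6 * + triangles G)))
      where
      cancel : ∀ w t → w - (w - t) ≡ t
      cancel = solve-∀

    -- By `T≤6triangles` the deficit is at most the gap `W - N * T`, so its square may replace that
    -- of the gap in `fractional-cut`; `sign-rounding` then yields the partition.
    surplus-bound : 0ℤ < N → 0ℤ < deficit → ∀ Δ → (∀ u → deg G u ℕ.≤ Δ) →
      ∃ λ P → deficit * deficit ≤ + 72 * (N * + Δ * W) * (+ 4 * + cut G P - + 2 * + edges G)
    surplus-bound 0<N 0<deficit Δ deg≤Δ = P , (begin
      deficit * deficit
        ≤⟨ *-monoˡ 0≤deficit deficit≤g ⟩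
      deficit * (W - N * T)
        ≤⟨ subst₂ _≤_ (ℤ.*-comm (W - N * T) deficit) refl (*-monoˡ (ℤ.≤-trans 0≤deficit deficit≤g) deficit≤g) ⟩
      (W - N * T) * (W - N * T)
        ≤⟨ proj₂ (proj₂ fractional) ⟩
      + 36 * (M * W) * (0ℤ - Q a x)
        ≤⟨ *-monoˡ (0≤-* (0≤+ {36}) (ℤ.<⇒≤ (0<-* 0<M 0<W))) (ℤ.+-monoʳ-≤ 0ℤ (ℤ.neg-mono-≤ (proj₂ rounded))) ⟩
      + 36 * (M * W) * (0ℤ - Q a (λ u → sgn (P u)))
        ≡⟨ cong (λ s → + 36 * (M * W) * s) (Q-cut P) ⟩
      + 36 * (M * W) * (+ 4 * + cut G P - + 2 * + edges G)
        ≡⟨ regroup N (+ Δ) W (+ 4 * + cut G P - + 2 * + edges G) ⟩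
      + 72 * (N * + Δ * W) * (+ 4 * + cut G P - + 2 * + edges G) ∎)
      where
      open ℤ.≤-Reasoning
      regroup : ∀ N Δ W X → + 36 * (+ 2 * (N * Δ) * W) * X ≡ + 72 * (N * Δ * W) * X
      regroup = solve-∀
      0≤deficit : 0ℤ ≤ deficit
      0≤deficit = ℤ.<⇒≤ 0<deficit
      deficit≤g : deficit ≤ W - N * T
      deficit≤g = ℤ.+-monoʳ-≤ W (ℤ.neg-mono-≤ (*-monoˡ 0≤N T≤6triangles))
      0<W : 0ℤ < W
      0<W = ℤ.<-≤-trans 0<deficit deficit≤W
      d≤Δ : ∀ u → d u ≤ + Δ
      d≤Δ u = subst (_≤ + Δ) (sym (d-≡ u)) (+≤+ (deg≤Δ u))
      D≤nΔ : D ≤ + n * + Δ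
      D≤nΔ = subst (D ≤_) (sum-const n (+ Δ)) (sum-mono d≤Δ)
      W≤ : W ≤ + n * S * + Δ
      W≤ = subst₂ _≤_ (ℤ.*-comm S D) (swap S (+ n) (+ Δ)) (*-monoˡ 0≤S D≤nΔ)
        where
        swap : ∀ S n Δ → S * (n * Δ) ≡ n * S * Δ
        swap = solve-∀
      -- `m̄ u` equals `N d u + n D`, where both summands are at most `N Δ`; this factor `2` turns
      -- `36` into `72`.
      M : ℤ
      M = + 2 * (N * + Δ)
      -- If `Δ` were zero, `W` would not be positive, contradicting the positive deficit.
      0<Δ : 0ℤ < + Δ
      0<Δ = positive Δ (ℤ.<-≤-trans 0<W W≤)
        where
        positive : ∀ k → 0ℤ < + n * S * + k → 0ℤ < + k
        positive zero    h = ⊥-elim (ℤ.<-irrefl refl (subst (0ℤ <_) (ℤ.*-zeroʳ (+ n * S)) h))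
        positive (suc k) h = +<+ (ℕ.s≤s ℕ.z≤n)
      0<M : 0ℤ < M
      0<M = 0<-* {+ 2} (+<+ (ℕ.s≤s ℕ.z≤n)) (0<-* 0<N 0<Δ)
      m̄≤M : ∀ u → m̄ u ≤ M
      m̄≤M u = begin
        m̄ u
          ≡⟨ m̄-≡ u ⟩
        N * d u + + n * D
          ≤⟨ ℤ.+-mono-≤ (*-monoˡ 0≤N (d≤Δ u)) (*-monoˡ (0≤+ {n}) D≤nΔ) ⟩
        N * + Δ + + n * (+ n * + Δ)
          ≡⟨ double (+ n) (+ Δ) ⟩
        M ∎
        where
        double : ∀ n Δ → n * n * Δ + n * (n * Δ) ≡ + 2 * (n * n * Δ)
        double = solve-∀
      fractional : _
      fractional = fractional-cut 0<N (ℤ.<-≤-trans 0<deficit deficit≤g) M 0<M m̄≤M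
      x : Fin n → ℤ
      x = proj₁ fractional
      rounded : _
      rounded = sign-rounding a a-diag x (proj₁ (proj₂ fractional))
      P : Fin n → Bool
      P = proj₁ rounded

open Integral
open import Data.Rational using (ℚ; 0ℚ; 1ℚ; _<_; _≤_; _*_; _-_; _+_; -_; _/_; toℚᵘ; fromℚᵘ)
open import Data.Rational.Unnormalised using (mkℚᵘ; *≡*)
open import Data.Rational.Solver using (module +-*-Solver)
open +-*-Solver

-- Rational arithmetic

≤-byℚ : ∀ {p q} e → 0ℚ ≤ e → q - p ≡ e → p ≤ q
≤-byℚ {p} {q} e 0≤e eq = subst₂ _≤_ (ℚ.+-identityʳ p)
  (trans (cong (λ s → p + s) (sym eq)) (solve 2 (λ p q → p :+ (q :- p) := q) refl p q))
  (ℚ.+-monoʳ-≤ p 0≤e)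

0≤-ℚ : ∀ {p q} → p ≤ q → 0ℚ ≤ q - p
0≤-ℚ {p} {q} h = subst (_≤ q - p) (ℚ.+-inverseʳ p) (ℚ.+-monoˡ-≤ (- p) h)

0≤+ℚ : ∀ {p q} → 0ℚ ≤ p → 0ℚ ≤ q → 0ℚ ≤ p + q
0≤+ℚ = ℚ.+-mono-≤

0≤*ℚ : ∀ {p q} → 0ℚ ≤ p → 0ℚ ≤ q → 0ℚ ≤ p * q
0≤*ℚ {p} {q} 0≤p 0≤q = subst (_≤ p * q) (ℚ.*-zeroʳ p) (ℚ.*-monoˡ-≤-nonNeg p {{ℚ.nonNegative 0≤p}} 0≤q)

0<*ℚ : ∀ {p q} → 0ℚ < p → 0ℚ < q → 0ℚ < p * q
0<*ℚ {p} {q} 0<p 0<q = subst (_< p * q) (ℚ.*-zeroʳ p) (ℚ.*-monoʳ-<-pos p {{ℚ.positive 0<p}} 0<q)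

0≤-cancelℚ : ∀ {k p} → 0ℚ < k → 0ℚ ≤ k * p → 0ℚ ≤ p
0≤-cancelℚ {k} {p} 0<k h = ℚ.*-cancelˡ-≤-pos k {{ℚ.positive 0<k}} (subst (_≤ k * p) (sym (ℚ.*-zeroʳ k)) h)

c6 c72 : ℚ
c6 = + 6 / 1
c72 = + 72 / 1

-- The triangle hypothesis times `6 n²`. The reciprocal `i` is a variable for the ring solver, and
-- `n * i ≡ 1ℚ` is substituted afterwards.
deficit-lower-bound : ∀ {n i D S t ε} → n * i ≡ 1ℚ → 0ℚ < n →
  t < (1ℚ - ε) * ((D * i * (+ 1 / 6)) * i) * S →
  ε * (D * S) < D * S - n * n * (c6 * t)
deficit-lower-bound {n} {i} {D} {S} {t} {ε} ni≡1 0<n h = subst₂ _<_ left right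
  (ℚ.+-monoʳ-< (D * S) (ℚ.neg-antimono-< (ℚ.*-monoʳ-<-pos (n * n * c6) {{ℚ.positive (0<*ℚ (0<*ℚ 0<n 0<n) (ℚ.positive⁻¹ c6))}} h)))
  where
  left : D * S + - (n * n * c6 * ((1ℚ - ε) * ((D * i * (+ 1 / 6)) * i) * S)) ≡ ε * (D * S)
  left = trans (solve 5 (λ n i D S ε → D :* S :+ :- (n :* n :* con c6 :* ((con 1ℚ :- ε) :* ((D :* i :* con (+ 1 / 6)) :* i) :* S))
                   := D :* S :- (n :* i) :* (n :* i) :* ((con 1ℚ :- ε) :* (D :* S))) refl n i D S ε)
         (trans (cong (λ r → D * S - r * r * ((1ℚ - ε) * (D * S))) ni≡1)
           (solve 2 (λ e W → W :- con 1ℚ :* con 1ℚ :* ((con 1ℚ :- e) :* W) := e :* W) refl ε (D * S)))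
  right : D * S + - (n * n * c6 * t) ≡ D * S - n * n * (c6 * t)
  right = cong (λ s → D * S - s) (ℚ.*-assoc (n * n) c6 t)

-- Cancelling `W` from `ε² W² ≤ f²` gives `ε² W ≤ 72 n² Δ X ≤ 72 n C D X`, while `W ≥ D³ / n` by
-- Cauchy-Schwarz. Division by `n D` yields the bound.
endgame : ∀ {n i D W Δ X f ε C} → n * i ≡ 1ℚ → 0ℚ < n → 0ℚ ≤ i → 0ℚ < D → 0ℚ < W → 0ℚ ≤ Δ → 0ℚ < ε →
  0ℚ < f → ε * W ≤ f → f * f ≤ c72 * (n * n * Δ * W) * X → Δ ≤ C * (D * i) → n * (D * D) * D ≤ n * n * W →
  ε * ε * (D * i * (D * i)) ≤ c72 * (C * X)
endgame {n} {i} {D} {W} {Δ} {X} {f} {ε} {C} ni≡1 0<n 0≤i 0<D 0<W 0≤Δ 0<ε 0<f εW≤f f²≤ Δ≤ cauchy =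
  ≤-byℚ _ (0≤-cancelℚ 0<D (subst (0ℚ ≤_) total 0≤cert)) refl
  where
  0≤n : 0ℚ ≤ n
  0≤n = ℚ.<⇒≤ 0<n
  0≤W : 0ℚ ≤ W
  0≤W = ℚ.<⇒≤ 0<W
  0≤ε : 0ℚ ≤ ε
  0≤ε = ℚ.<⇒≤ 0<ε
  0≤c72 : 0ℚ ≤ c72
  0≤c72 = ℚ.nonNegative⁻¹ c72
  r A : ℚ
  r = n * i
  A = c72 * (n * n * Δ) * X - ε * ε * W
  0≤r : 0ℚ ≤ r
  0≤r = 0≤*ℚ 0≤n 0≤i
  -- This sign allows `Δ ≤ C D i` to be multiplied by `X`; with `X ≤ 0` the bound on `f * f` would
  -- contradict `0 < f`.
  0≤X : 0ℚ ≤ X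
  0≤X with ℚ.≤-total 0ℚ X
  ... | inj₁ h = h
  ... | inj₂ h = ⊥-elim (ℚ.<-irrefl refl (ℚ.<-≤-trans (0<*ℚ 0<f 0<f) (ℚ.≤-trans f²≤
          (subst (c72 * (n * n * Δ * W) * X ≤_) (ℚ.*-zeroʳ (c72 * (n * n * Δ * W)))
            (ℚ.*-monoˡ-≤-nonNeg (c72 * (n * n * Δ * W)) {{ℚ.nonNegative (0≤*ℚ 0≤c72 (0≤*ℚ (0≤*ℚ (0≤*ℚ 0≤n 0≤n) 0≤Δ) 0≤W))}} h)))))
  -- Uses that `f² - ε² W²` factors as `(f - ε W) (f + ε W)`, a product of nonnegative numbers.
  0≤A : 0ℚ ≤ A
  0≤A = 0≤-cancelℚ 0<W (subst (0ℚ ≤_)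
    (solve 6 (λ n Δ X W f ε →
        (con c72 :* (n :* n :* Δ :* W) :* X :- f :* f) :+ (f :- ε :* W) :* (f :+ ε :* W)
          := W :* (con c72 :* (n :* n :* Δ) :* X :- ε :* ε :* W)) refl n Δ X W f ε)
    (0≤+ℚ (0≤-ℚ f²≤) (0≤*ℚ (0≤-ℚ εW≤f) (0≤+ℚ (ℚ.<⇒≤ 0<f) (0≤*ℚ 0≤ε 0≤W)))))
  -- Equals D (72 C X - ε² (D i)²) once n i = 1; the powers of r make the terms in Δ and W cancel identically.
  cert : ℚ
  cert = r * n * (i * i) * A + ε * ε * (i * i * i) * (n * n * W - n * (D * D) * D)
           + r * r * r * (c72 * n * X) * (C * (D * i) - Δ)
  0≤cert : 0ℚ ≤ cert
  0≤cert = 0≤+ℚ (0≤+ℚ (0≤*ℚ (0≤*ℚ (0≤*ℚ 0≤r 0≤n) (0≤*ℚ 0≤i 0≤i)) 0≤A)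
      (0≤*ℚ (0≤*ℚ (0≤*ℚ 0≤ε 0≤ε) (0≤*ℚ (0≤*ℚ 0≤i 0≤i) 0≤i)) (0≤-ℚ cauchy)))
      (0≤*ℚ (0≤*ℚ (0≤*ℚ (0≤*ℚ 0≤r 0≤r) 0≤r) (0≤*ℚ (0≤*ℚ 0≤c72 0≤n) 0≤X)) (0≤-ℚ Δ≤))
  total : cert ≡ D * (c72 * (C * X) - ε * ε * (D * i * (D * i)))
  total = trans
    (solve 8 (λ n i D W Δ X ε C →
        n :* i :* n :* (i :* i) :* (con c72 :* (n :* n :* Δ) :* X :- ε :* ε :* W)
          :+ ε :* ε :* (i :* i :* i) :* (n :* n :* W :- n :* (D :* D) :* D)
          :+ n :* i :* (n :* i) :* (n :* i) :* (con c72 :* n :* X) :* (C :* (D :* i) :- Δ)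
        := D :* (n :* i :* (n :* i) :* (n :* i) :* (n :* i) :* (con c72 :* (C :* X)) :- n :* i :* (ε :* ε :* (D :* i :* (D :* i)))))
      refl n i D W Δ X ε C)
    (trans (cong (λ r → D * (r * r * r * r * (c72 * (C * X)) - r * (ε * ε * (D * i * (D * i))))) ni≡1)
      (solve 3 (λ D p q → D :* (con 1ℚ :* con 1ℚ :* con 1ℚ :* con 1ℚ :* p :- con 1ℚ :* q) := D :* (p :- q)) refl D (c72 * (C * X)) (ε * ε * (D * i * (D * i)))))

-- The integers inside the rationals

fromℚᵘ-+ : ∀ p q → fromℚᵘ (p ℚᵘ.+ q) ≡ fromℚᵘ p + fromℚᵘ q
fromℚᵘ-+ p q = ℚ.toℚᵘ-injective (begin
  toℚᵘ (fromℚᵘ (p ℚᵘ.+ q))             ≈⟨ ℚ.toℚᵘ-fromℚᵘ (p ℚᵘ.+ q) ⟩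
  p ℚᵘ.+ q                             ≈⟨ ℚᵘ.+-cong (ℚ.toℚᵘ-fromℚᵘ p) (ℚ.toℚᵘ-fromℚᵘ q) ⟨
  toℚᵘ (fromℚᵘ p) ℚᵘ.+ toℚᵘ (fromℚᵘ q) ≈⟨ ℚ.toℚᵘ-homo-+ (fromℚᵘ p) (fromℚᵘ q) ⟨
  toℚᵘ (fromℚᵘ p + fromℚᵘ q)           ∎)
  where open ℚᵘ.≃-Reasoning

fromℚᵘ-* : ∀ p q → fromℚᵘ (p ℚᵘ.* q) ≡ fromℚᵘ p * fromℚᵘ q
fromℚᵘ-* p q = ℚ.toℚᵘ-injective (begin
  toℚᵘ (fromℚᵘ (p ℚᵘ.* q))             ≈⟨ ℚ.toℚᵘ-fromℚᵘ (p ℚᵘ.* q) ⟩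
  p ℚᵘ.* q                             ≈⟨ ℚᵘ.*-cong (ℚ.toℚᵘ-fromℚᵘ p) (ℚ.toℚᵘ-fromℚᵘ q) ⟨
  toℚᵘ (fromℚᵘ p) ℚᵘ.* toℚᵘ (fromℚᵘ q) ≈⟨ ℚ.toℚᵘ-homo-* (fromℚᵘ p) (fromℚᵘ q) ⟨
  toℚᵘ (fromℚᵘ p * fromℚᵘ q)           ∎)
  where open ℚᵘ.≃-Reasoning

-- `ι (+ k)` unfolds to the same term as `ℕtoℚ k`, so hypotheses on graph parameters apply to it
-- directly.
ι : ℤ → ℚ
ι i = i / 1

-- Division in `ℚ` normalises by a gcd; among unnormalised fractions with denominator `1` the claim
-- is a polynomial identity.
ι-+ : ∀ i j → ι (i ℤ.+ j) ≡ ι i + ι j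
ι-+ i j = trans (ℚ.fromℚᵘ-cong {mkℚᵘ (i ℤ.+ j) 0} {mkℚᵘ i 0 ℚᵘ.+ mkℚᵘ j 0} (*≡* (eq i j))) (fromℚᵘ-+ (mkℚᵘ i 0) (mkℚᵘ j 0))
  where
  eq : ∀ i j → (i ℤ.+ j) ℤ.* 1ℤ ≡ (i ℤ.* 1ℤ ℤ.+ j ℤ.* 1ℤ) ℤ.* 1ℤ
  eq = solve-∀

ι-* : ∀ i j → ι (i ℤ.* j) ≡ ι i * ι j
ι-* i j = trans (ℚ.fromℚᵘ-cong {mkℚᵘ (i ℤ.* j) 0} {mkℚᵘ i 0 ℚᵘ.* mkℚᵘ j 0} (*≡* refl)) (fromℚᵘ-* (mkℚᵘ i 0) (mkℚᵘ j 0))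

ι-mono : ∀ {i j} → i ℤ.≤ j → ι i ≤ ι j
ι-mono {i} {j} h = ℚ.toℚᵘ-cancel-≤ (begin
  toℚᵘ (ι i)  ≃⟨ ℚ.toℚᵘ-fromℚᵘ (mkℚᵘ i 0) ⟩
  mkℚᵘ i 0    ≤⟨ ℚᵘ.*≤* (ℤ.*-monoʳ-≤-nonNeg 1ℤ h) ⟩
  mkℚᵘ j 0    ≃⟨ ℚ.toℚᵘ-fromℚᵘ (mkℚᵘ j 0) ⟨
  toℚᵘ (ι j)  ∎)
  where open ℚᵘ.≤-Reasoning

ι-cancel-< : ∀ {i j} → ι i < ι j → i ℤ.< j
ι-cancel-< {i} {j} h = ℤ.≰⇒> λ j≤i → ℚ.<-irrefl refl (ℚ.<-≤-trans h (ι-mono j≤i))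

ι-mono-< : ∀ {i j} → i ℤ.< j → ι i < ι j
ι-mono-< {i} {j} h = ℚ.toℚᵘ-cancel-< (begin-strict
  toℚᵘ (ι i)  ≃⟨ ℚ.toℚᵘ-fromℚᵘ (mkℚᵘ i 0) ⟩
  mkℚᵘ i 0    <⟨ ℚᵘ.*<* (ℤ.*-monoʳ-<-pos 1ℤ h) ⟩
  mkℚᵘ j 0    ≃⟨ ℚ.toℚᵘ-fromℚᵘ (mkℚᵘ j 0) ⟨
  toℚᵘ (ι j)  ∎)
  where open ℚᵘ.≤-Reasoning

ι-- : ∀ i j → ι (i ℤ.- j) ≡ ι i - ι j
ι-- i j = begin
  ι (i ℤ.- j)                  ≡⟨ solve 2 (λ p q → p := p :+ q :- q) refl (ι (i ℤ.- j)) (ι j) ⟩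
  ι (i ℤ.- j) + ι j - ι j      ≡⟨ cong (_- ι j) (ι-+ (i ℤ.- j) j) ⟨
  ι (i ℤ.- j ℤ.+ j) - ι j      ≡⟨ cong (λ k → ι k - ι j) (cancel i j) ⟩
  ι i - ι j ∎
  where
  open ≡-Reasoning
  cancel : ∀ i j → i ℤ.- j ℤ.+ j ≡ i
  cancel = solve-∀

/-ι : ∀ i n .{{_ : NonZero n}} → i / n ≡ ι i * inv n
/-ι i (suc k) = trans (ℚ.fromℚᵘ-cong {mkℚᵘ i k} {mkℚᵘ i 0 ℚᵘ.* mkℚᵘ (+ 1) k} (*≡* (eq i (+ suc k)))) (fromℚᵘ-* (mkℚᵘ i 0) (mkℚᵘ (+ 1) k))
  where
  eq : ∀ i n → i ℤ.* (1ℤ ℤ.* n) ≡ i ℤ.* 1ℤ ℤ.* n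
  eq = solve-∀

ι-inv : ∀ n .{{_ : NonZero n}} → ι (+ n) * inv n ≡ 1ℚ
ι-inv n@(suc k) = trans (sym (/-ι (+ n) n)) (ℚ.fromℚᵘ-cong {mkℚᵘ (+ n) k} {mkℚᵘ (+ 1) 0} (*≡* (ℤ.*-comm (+ n) 1ℤ)))

0≤inv : ∀ n .{{_ : NonZero n}} → 0ℚ ≤ inv n
0≤inv n@(suc k) = ℚ.nonNegative⁻¹ (inv n) {{ℚ.normalize-nonNeg 1 n}}

-- The surplus and the final bound

surplus : ∀ {n} (G : Graph n) P → ι (+ 4 ℤ.* + cut G P ℤ.- + 2 ℤ.* + edges G) ≤ (+ 4 / 1) * sp G
surplus G P = begin
  ι (+ 4 ℤ.* + cut G P ℤ.- + 2 ℤ.* + edges G)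
    ≡⟨ ι-- (+ 4 ℤ.* + cut G P) (+ 2 ℤ.* + edges G) ⟩
  ι (+ 4 ℤ.* + cut G P) - ι (+ 2 ℤ.* + edges G)
    ≡⟨ cong (λ s → ι (+ 4 ℤ.* + cut G P) - s) (ι-* (+ 2) (+ edges G)) ⟩
  ι (+ 4 ℤ.* + cut G P) - ι (+ 2) * ι (+ edges G)
    ≤⟨ ℚ.+-monoˡ-≤ (- (ι (+ 2) * ι (+ edges G))) (ι-mono (*-monoˡ (0≤+ {4}) (+≤+ (GraphSums.cut≤mc G P)))) ⟩
  ι (+ 4 ℤ.* + mc G) - ι (+ 2) * ι (+ edges G)
    ≡⟨ cong (_- ι (+ 2) * ι (+ edges G)) (ι-* (+ 4) (+ mc G)) ⟩
  ι (+ 4) * ι (+ mc G) - ι (+ 2) * ι (+ edges G)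
    ≡⟨ solve 2 (λ m e → con (ι (+ 4)) :* m :- con (ι (+ 2)) :* e := con (ι (+ 4)) :* (m :- e :* con (inv 2))) refl (ι (+ mc G)) (ι (+ edges G)) ⟩
  ι (+ 4) * (ι (+ mc G) - ι (+ edges G) * inv 2)
    ≡⟨ cong (λ h → ι (+ 4) * (ι (+ mc G) - h)) (/-ι (+ edges G) 2) ⟨
  (+ 4 / 1) * sp G ∎
  where
  open ℚ.≤-Reasoning

theorem2p7 : Σ ℚ λ c → (0ℚ < c) ×
    ((n : ℕ) .{{_ : NonZero n}} (G : Graph n) (ε C : ℚ) →
    0ℚ < ε → 0ℚ < C →
    (∀ (u : Fin n) → ℕtoℚ (deg G u) ≤ C * avgDeg G) →
    ℕtoℚ (triangles G) < (1ℚ - ε) * ((avgDeg G * ((+ 1) / 6)) * inv n) * ℕtoℚ (sumDegSq G) →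
    c * (ε * ε) * (avgDeg G * avgDeg G) ≤ C * sp G)
theorem2p7 = (+ 1) / 288 , ℚ.positive⁻¹ ((+ 1) / 288) , λ { (suc k) → bound k }
  where
  -- The order is matched as `suc k` because `argmax` needs at least one vertex.
  bound : ∀ k (G : Graph (suc k)) (ε C : ℚ) → 0ℚ < ε → 0ℚ < C →
    (∀ u → ℕtoℚ (deg G u) ≤ C * avgDeg G) →
    ℕtoℚ (triangles G) < (1ℚ - ε) * ((avgDeg G * ((+ 1) / 6)) * inv (suc k)) * ℕtoℚ (sumDegSq G) →
    (+ 1) / 288 * (ε * ε) * (avgDeg G * avgDeg G) ≤ C * sp G
  bound k G ε C 0<ε 0<C deg≤ sparse = begin
    (+ 1) / 288 * (ε * ε) * (avgDeg G * avgDeg G)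
      ≡⟨ cong (λ a → (+ 1) / 288 * (ε * ε) * (a * a)) avgDeg-≡ ⟩
    (+ 1) / 288 * (ε * ε) * (ι D * i * (ι D * i))
      ≡⟨ ℚ.*-assoc ((+ 1) / 288) (ε * ε) (ι D * i * (ι D * i)) ⟩
    (+ 1) / 288 * (ε * ε * (ι D * i * (ι D * i)))
      ≤⟨ ℚ.*-monoˡ-≤-nonNeg ((+ 1) / 288) (endgame {ι (+ n)} {i} {ι D} {ι W} {ι (+ Δ)} {ι X} {ι deficit} {ε} {C}
           ni≡1 0<ιn (0≤inv n) (ι-mono-< 0<D) (ι-mono-< 0<W) (ι-mono (0≤+ {Δ})) 0<ε (ι-mono-< 0<deficit)
           (subst (λ s → ε * s ≤ ι deficit) (sym (ι-* D S)) (ℚ.<⇒≤ εW<deficit))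
           deficit² Δ≤ cauchy) ⟩
    (+ 1) / 288 * (c72 * (C * ι X))
      ≤⟨ ℚ.*-monoˡ-≤-nonNeg ((+ 1) / 288) (ℚ.*-monoˡ-≤-nonNeg c72 (ℚ.*-monoˡ-≤-nonNeg C {{ℚ.nonNegative (ℚ.<⇒≤ 0<C)}} (surplus G P))) ⟩
    (+ 1) / 288 * (c72 * (C * ((+ 4 / 1) * sp G)))
      -- Here `288 = 72 * 4`: the `72` comes from `endgame`, the `4` from bounding `4 cut - 2 edges`
      -- by `4 sp G`.
      ≡⟨ solve 2 (λ C s → con ((+ 1) / 288) :* (con c72 :* (C :* (con (+ 4 / 1) :* s))) := C :* s) refl C (sp G) ⟩
    C * sp G ∎
    where
    open ℚ.≤-Reasoning
    open GraphSums G
    n : ℕ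
    n = suc k
    i : ℚ
    i = inv n
    0<n : 0ℤ ℤ.< + n
    0<n = +<+ (ℕ.s≤s ℕ.z≤n)
    0<ιn : 0ℚ < ι (+ n)
    0<ιn = ι-mono-< 0<n
    ni≡1 : ι (+ n) * i ≡ 1ℚ
    ni≡1 = ι-inv n
    avgDeg-≡ : avgDeg G ≡ ι D * i
    avgDeg-≡ = trans (/-ι (+ sumDeg G) n) (cong (λ s → ι s * i) (sym D-≡))
    ι-deficit : ι deficit ≡ ι D * ι S - ι (+ n) * ι (+ n) * (c6 * ι (+ triangles G))
    ι-deficit = trans (ι-- W (N ℤ.* (+ 6 ℤ.* + triangles G))) (cong₂ _-_ (ι-* D S)
      (trans (ι-* N (+ 6 ℤ.* + triangles G)) (cong₂ _*_ (ι-* (+ n) (+ n)) (ι-* (+ 6) (+ triangles G)))))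
    εW<deficit : ε * (ι D * ι S) < ι deficit
    εW<deficit = subst (ε * (ι D * ι S) <_) (sym ι-deficit)
      (deficit-lower-bound {ι (+ n)} {i} {ι D} {ι S} {ι (+ triangles G)} {ε} ni≡1 0<ιn
        (subst₂ (λ a s → ι (+ triangles G) < (1ℚ - ε) * ((a * ((+ 1) / 6)) * i) * ι s) avgDeg-≡ (sym S-≡) sparse))
    0<deficit : 0ℤ ℤ.< deficit
    0<deficit = ι-cancel-< (ℚ.≤-<-trans (0≤*ℚ (ℚ.<⇒≤ 0<ε) (0≤*ℚ (ι-mono 0≤D) (ι-mono 0≤S))) εW<deficit)
    0<W : 0ℤ ℤ.< W
    0<W = ℤ.<-≤-trans 0<deficit deficit≤W
    0<D : 0ℤ ℤ.< D
    0<D = ℤ.≰⇒> λ D≤0 → ℤ.<⇒≱ 0<W (subst₂ ℤ._≤_ (ℤ.*-comm S D) (ℤ.*-zeroʳ S) (*-monoˡ 0≤S D≤0))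
    extremal : ∃ λ u → ∀ v → deg G v ℕ.≤ deg G u
    extremal = argmax (deg G)
    -- The maximum degree is an attained integer: the integral argument can use it, and the degree
    -- hypothesis at its vertex bounds it by `C` times the average degree.
    Δ : ℕ
    Δ = deg G (proj₁ extremal)
    Δ≤ : ι (+ Δ) ≤ C * (ι D * i)
    Δ≤ = subst (λ a → ι (+ Δ) ≤ C * a) avgDeg-≡ (deg≤ (proj₁ extremal))
    bounded : _
    bounded = surplus-bound (0<-* 0<n 0<n) 0<deficit Δ (proj₂ extremal)
    P : _
    P = proj₁ bounded
    X : ℤ
    X = + 4 ℤ.* + cut G P ℤ.- + 2 ℤ.* + edges G
    deficit² : ι deficit * ι deficit ≤ c72 * (ι (+ n) * ι (+ n) * ι (+ Δ) * ι W) * ι X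
    deficit² = subst₂ _≤_ (ι-* deficit deficit)
      (trans (ι-* (+ 72 ℤ.* (N ℤ.* + Δ ℤ.* W)) X) (cong (_* ι X)
        (trans (ι-* (+ 72) (N ℤ.* + Δ ℤ.* W)) (cong (c72 *_)
          (trans (ι-* (N ℤ.* + Δ) W) (cong (_* ι W)
            (trans (ι-* N (+ Δ)) (cong (_* ι (+ Δ)) (ι-* (+ n) (+ n))))))))))
      (ι-mono (proj₂ bounded))
    cauchy : ι (+ n) * (ι D * ι D) * ι D ≤ ι (+ n) * ι (+ n) * ι W
    cauchy = subst₂ _≤_
      (trans (ι-* (+ n ℤ.* (D ℤ.* D)) D) (cong (_* ι D) (trans (ι-* (+ n) (D ℤ.* D)) (cong (ι (+ n) *_) (ι-* D D)))))
      (trans (ι-* N W) (cong (_* ι W) (ι-* (+ n) (+ n))))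
      (ι-mono nD³≤NW)
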